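{- Let $a,b\in\mathbb{C}$ and let $m,n\ge 0$ be integers. Define $S_n(a,b,m)=\sum_{k=0}^n\binom{n}{k}a^kb^{n-k}H_k(m)$. Then $$S_n(a,b,m)=\sum_{j=0}^m\binom{m}{j}\sum_{k=0}^n H_k(j)\,(a+b)^k\,\frac{(m-j)!}{(n-k)!}\,(-1)^{n-k}\,b^{n-k}\,s(n-k,m-j).$$
   Context: For integers $m\ge 1$, $n\ge 0$, the multiple harmonic-like numbers are $H_n(m)=\sum_{1\le k_1+k_2+\cdots+k_m\le n}\frac{1}{k_1k_2\cdots k_m}$ (sum over positive integers $k_1,\dots,k_m$), with $H_n(0)=1$ for $n\ge 0$ and $H_0(m)=0$ for $m\ge1$. Equivalently, $\sum_{n\ge0}H_n(m)z^n=\frac{(-\ln(1-z))^m}{1-z}$. The (signed) Stirling numbers of the first kind $s(n,k)$ are defined by $\sum_{n\ge k}s(n,k)\frac{z^n}{n!}=\frac{\ln^k(1+z)}{k!}$, with $s(n,k)=0$ for $n<k$. Convention $0^0=1$. -}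

module Defs where

open import Algebra.Bundles using (CommutativeRing; Semiring)
open import Algebra.Structures using (IsCommutativeRing)
import Algebra.Definitions.RawMonoid as RawMonoidOps
import Algebra.Definitions.RawSemiring as RawSemiringOps
open import Data.Fin.Base as Fin using (Fin; toℕ)
open import Data.Fin.Properties using (toℕ<n)
open import Data.Integer.Base as ℤ using (ℤ; +_; 1ℤ; -1ℤ)
open import Data.List.Base as List using (List; allFin; cartesianProductWith; filter)
open import Data.Nat.Base as ℕ using (ℕ; zero; suc; _∸_; _≤_; _⊔_; _!)
open import Data.Nat.Combinatorics using (_C_)
import Data.Nat.Properties as ℕₚ
open import Data.Product.Base using (∃; _×_; _,_; proj₁; proj₂)
open import Data.Rational.Base as ℚ using (ℚ; 0ℚ; 1ℚ; ½; _/_)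
import Data.Rational.Properties as ℚₚ
open import Data.Rational.Solver using (module +-*-Solver)
open import Data.Vec.Base as Vec using (Vec; []; _∷_)
open import Level using (0ℓ)
open import Relation.Binary.PropositionalEquality using (_≡_; refl; sym; trans; cong; cong₂; subst)
open import Relation.Binary.Structures using (IsEquivalence)
open import Relation.Nullary.Decidable using (_×-dec_)

------------------------------------------------------------------------
-- Real numbers: Cauchy sequences of rationals, equal when their
-- difference tends to 0.

IsCauchy : (ℕ → ℚ) → Set
IsCauchy x = ∀ ε → 0ℚ ℚ.< ε →
  ∃ λ N → ∀ i j → N ≤ i → N ≤ j → ℚ.∣ x i ℚ.- x j ∣ ℚ.< ε

record ℝ : Set where
  no-eta-equality
  field
    seq    : ℕ → ℚ
    cauchy : IsCauchy seq

open ℝ public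

infix 4 _≈ᴿ_

record _≈ᴿ_ (x y : ℝ) : Set where
  constructor mk≈ᴿ
  field
    close : ∀ ε → 0ℚ ℚ.< ε →
      ∃ λ N → ∀ i → N ≤ i → ℚ.∣ seq x i ℚ.- seq y i ∣ ℚ.< ε

open _≈ᴿ_ public

private
  0<½* : ∀ {ε} → 0ℚ ℚ.< ε → 0ℚ ℚ.< ½ ℚ.* ε
  0<½* {ε} 0<ε = ℚₚ.positive⁻¹ (½ ℚ.* ε) {{ℚₚ.pos*pos⇒pos ½ ε {{ℚ.positive 0<ε}}}}

  ½+½ : ∀ ε → ½ ℚ.* ε ℚ.+ ½ ℚ.* ε ≡ ε
  ½+½ ε = trans (sym (ℚₚ.*-distribʳ-+ ε ½ ½)) (ℚₚ.*-identityˡ ε)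

  ∣p-p∣ : ∀ {p q ε} → p ≡ q → 0ℚ ℚ.< ε → ℚ.∣ p ℚ.- q ∣ ℚ.< ε
  ∣p-p∣ {p} {ε = ε} refl 0<ε =
    subst (λ z → ℚ.∣ z ∣ ℚ.< ε) (sym (ℚₚ.+-inverseʳ p)) 0<ε

  ∣-∣-swap : ∀ p q → ℚ.∣ p ℚ.- q ∣ ≡ ℚ.∣ q ℚ.- p ∣
  ∣-∣-swap p q = trans (sym (ℚₚ.∣-p∣≡∣p∣ (p ℚ.- q))) (cong ℚ.∣_∣
    (solve 2 (λ p q → :- (p :- q) := q :- p) refl p q))
    where open +-*-Solver

  sum-bound : ∀ {p q ε} r → r ≡ p ℚ.+ q →
    ℚ.∣ p ∣ ℚ.< ½ ℚ.* ε → ℚ.∣ q ∣ ℚ.< ½ ℚ.* ε → ℚ.∣ r ∣ ℚ.< ε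
  sum-bound {p} {q} {ε} r refl p< q< =
    subst (ℚ.∣ p ℚ.+ q ∣ ℚ.<_) (½+½ ε)
      (ℚₚ.≤-<-trans (ℚₚ.∣p+q∣≤∣p∣+∣q∣ p q) (ℚₚ.+-mono-< p< q<))

  +-bound : ∀ p p′ q q′ {ε} → ℚ.∣ p ℚ.- p′ ∣ ℚ.< ½ ℚ.* ε → ℚ.∣ q ℚ.- q′ ∣ ℚ.< ½ ℚ.* ε →
    ℚ.∣ (p ℚ.+ q) ℚ.- (p′ ℚ.+ q′) ∣ ℚ.< ε
  +-bound p p′ q q′ = sum-bound _
    (solve 4 (λ p p′ q q′ → (p :+ q) :- (p′ :+ q′) := (p :- p′) :+ (q :- q′)) refl p p′ q q′)
    where open +-*-Solver

  trans-bound : ∀ p q r {ε} → ℚ.∣ p ℚ.- q ∣ ℚ.< ½ ℚ.* ε → ℚ.∣ q ℚ.- r ∣ ℚ.< ½ ℚ.* ε →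
    ℚ.∣ p ℚ.- r ∣ ℚ.< ε
  trans-bound p q r = sum-bound _
    (solve 3 (λ p q r → p :- r := (p :- q) :+ (q :- r)) refl p q r)
    where open +-*-Solver

  neg-bound : ∀ p q {ε} → ℚ.∣ p ℚ.- q ∣ ℚ.< ε → ℚ.∣ ℚ.- p ℚ.- ℚ.- q ∣ ℚ.< ε
  neg-bound p q {ε} = subst (ℚ._< ε) (trans (∣-∣-swap p q) (cong ℚ.∣_∣
    (solve 2 (λ p q → q :- p := :- p :- :- q) refl p q)))
    where open +-*-Solver

  *-bound : ∀ {A B} → 0ℚ ℚ.< A → 0ℚ ℚ.< B → ∀ ε → 0ℚ ℚ.< ε →
    ∃ λ δ → 0ℚ ℚ.< δ × (∀ p p′ q q′ → ℚ.∣ p ∣ ℚ.< A → ℚ.∣ q′ ∣ ℚ.< B →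
      ℚ.∣ p ℚ.- p′ ∣ ℚ.< δ → ℚ.∣ q ℚ.- q′ ∣ ℚ.< δ →
      ℚ.∣ p ℚ.* q ℚ.- p′ ℚ.* q′ ∣ ℚ.< ε)
  *-bound {A} {B} 0<A 0<B ε 0<ε = δ , 0<δ , bound
    where
    instance
      A⁺ : ℚ.Positive A
      A⁺ = ℚ.positive 0<A
      B⁺ : ℚ.Positive B
      B⁺ = ℚ.positive 0<B
      ε⁺ : ℚ.Positive ε
      ε⁺ = ℚ.positive 0<ε
      C⁺ : ℚ.Positive (A ℚ.+ B)
      C⁺ = ℚₚ.pos+pos⇒pos A B
      C≢0 : ℚ.NonZero (A ℚ.+ B)
      C≢0 = ℚₚ.pos⇒nonZero (A ℚ.+ B)
    δ = ε ℚ.* (ℚ.1/ (A ℚ.+ B))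
    instance
      1/C⁺ : ℚ.Positive (ℚ.1/ (A ℚ.+ B))
      1/C⁺ = ℚₚ.1/pos⇒pos (A ℚ.+ B)
    0<δ = ℚₚ.positive⁻¹ δ {{ℚₚ.pos*pos⇒pos ε (ℚ.1/ (A ℚ.+ B))}}
    split : A ℚ.* δ ℚ.+ δ ℚ.* B ≡ ε
    split = trans
      (solve 4 (λ a b e c → a :* (e :* c) :+ (e :* c) :* b := e :* (c :* (a :+ b))) refl
        A B ε (ℚ.1/ (A ℚ.+ B)))
      (trans (cong (ε ℚ.*_) (ℚₚ.*-inverseˡ (A ℚ.+ B))) (ℚₚ.*-identityʳ ε))
      where open +-*-Solver
    bound : ∀ p p′ q q′ → ℚ.∣ p ∣ ℚ.< A → ℚ.∣ q′ ∣ ℚ.< B →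
      ℚ.∣ p ℚ.- p′ ∣ ℚ.< δ → ℚ.∣ q ℚ.- q′ ∣ ℚ.< δ →
      ℚ.∣ p ℚ.* q ℚ.- p′ ℚ.* q′ ∣ ℚ.< ε
    bound p p′ q q′ p< q′< Δp< Δq< = begin-strict
      ℚ.∣ p ℚ.* q ℚ.- p′ ℚ.* q′ ∣
        ≡⟨ cong ℚ.∣_∣ (solve 4 (λ p p′ q q′ →
             p :* q :- p′ :* q′ := p :* (q :- q′) :+ (p :- p′) :* q′) refl p p′ q q′) ⟩
      ℚ.∣ p ℚ.* Δq ℚ.+ Δp ℚ.* q′ ∣
        ≤⟨ ℚₚ.∣p+q∣≤∣p∣+∣q∣ (p ℚ.* Δq) (Δp ℚ.* q′) ⟩
      ℚ.∣ p ℚ.* Δq ∣ ℚ.+ ℚ.∣ Δp ℚ.* q′ ∣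
        ≡⟨ cong₂ ℚ._+_ (ℚₚ.∣p*q∣≡∣p∣*∣q∣ p Δq) (ℚₚ.∣p*q∣≡∣p∣*∣q∣ Δp q′) ⟩
      ℚ.∣ p ∣ ℚ.* ℚ.∣ Δq ∣ ℚ.+ ℚ.∣ Δp ∣ ℚ.* ℚ.∣ q′ ∣
        ≤⟨ ℚₚ.+-mono-≤
             (ℚₚ.*-monoʳ-≤-nonNeg ℚ.∣ Δq ∣ {{ℚₚ.∣-∣-nonNeg Δq}} (ℚₚ.<⇒≤ p<))
             (ℚₚ.*-monoˡ-≤-nonNeg ℚ.∣ Δp ∣ {{ℚₚ.∣-∣-nonNeg Δp}} (ℚₚ.<⇒≤ q′<)) ⟩
      A ℚ.* ℚ.∣ Δq ∣ ℚ.+ ℚ.∣ Δp ∣ ℚ.* B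
        <⟨ ℚₚ.+-mono-< (ℚₚ.*-monoʳ-<-pos A Δq<) (ℚₚ.*-monoˡ-<-pos B Δp<) ⟩
      A ℚ.* δ ℚ.+ δ ℚ.* B
        ≡⟨ split ⟩
      ε ∎
      where
      open ℚₚ.≤-Reasoning
      open +-*-Solver
      Δp = p ℚ.- p′
      Δq = q ℚ.- q′

  eventually-bounded : ∀ x → IsCauchy x →
    ∃ λ A → 0ℚ ℚ.< A × ∃ λ N → ∀ i → N ≤ i → ℚ.∣ x i ∣ ℚ.< A
  eventually-bounded x cx = A , 0<A , N , bound
    where
    0<1 = ℚₚ.positive⁻¹ 1ℚ
    N = proj₁ (cx 1ℚ 0<1)
    A = 1ℚ ℚ.+ ℚ.∣ x N ∣
    0<A = ℚₚ.positive⁻¹ A {{ℚₚ.pos+nonNeg⇒pos 1ℚ ℚ.∣ x N ∣ {{ℚₚ.∣-∣-nonNeg (x N)}}}}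
    bound : ∀ i → N ≤ i → ℚ.∣ x i ∣ ℚ.< A
    bound i N≤i = begin-strict
      ℚ.∣ x i ∣
        ≡⟨ cong ℚ.∣_∣ (solve 2 (λ p q → p := (p :- q) :+ q) refl (x i) (x N)) ⟩
      ℚ.∣ (x i ℚ.- x N) ℚ.+ x N ∣
        ≤⟨ ℚₚ.∣p+q∣≤∣p∣+∣q∣ (x i ℚ.- x N) (x N) ⟩
      ℚ.∣ x i ℚ.- x N ∣ ℚ.+ ℚ.∣ x N ∣
        <⟨ ℚₚ.+-monoˡ-< ℚ.∣ x N ∣ (proj₂ (cx 1ℚ 0<1) i N N≤i ℕₚ.≤-refl) ⟩
      A ∎
      where
      open ℚₚ.≤-Reasoning
      open +-*-Solver

  ⊔ˡ : ∀ M N {i} → M ⊔ N ≤ i → M ≤ i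
  ⊔ˡ M N = ℕₚ.≤-trans (ℕₚ.m≤m⊔n M N)

  ⊔ʳ : ∀ M N {i} → M ⊔ N ≤ i → N ≤ i
  ⊔ʳ M N = ℕₚ.≤-trans (ℕₚ.m≤n⊔m M N)

  ⊔₄ : ∀ K L M N {i} → (K ⊔ L) ⊔ (M ⊔ N) ≤ i → K ≤ i × L ≤ i × M ≤ i × N ≤ i
  ⊔₄ K L M N h = ⊔ˡ K L KL , ⊔ʳ K L KL , ⊔ˡ M N MN , ⊔ʳ M N MN
    where
    KL = ⊔ˡ (K ⊔ L) (M ⊔ N) h
    MN = ⊔ʳ (K ⊔ L) (M ⊔ N) h

  +-cauchy : ∀ x y → IsCauchy x → IsCauchy y → IsCauchy (λ i → x i ℚ.+ y i)
  +-cauchy x y cx cy ε 0<ε with cx (½ ℚ.* ε) (0<½* 0<ε) | cy (½ ℚ.* ε) (0<½* 0<ε)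
  ... | M , p | N , q = M ⊔ N , λ i j hi hj →
    +-bound (x i) (x j) (y i) (y j) (p i j (⊔ˡ M N hi) (⊔ˡ M N hj)) (q i j (⊔ʳ M N hi) (⊔ʳ M N hj))

  neg-cauchy : ∀ x → IsCauchy x → IsCauchy (λ i → ℚ.- x i)
  neg-cauchy x cx ε 0<ε with cx ε 0<ε
  ... | N , p = N , λ i j hi hj → neg-bound (x i) (x j) (p i j hi hj)

  *-cauchy : ∀ x y → IsCauchy x → IsCauchy y → IsCauchy (λ i → x i ℚ.* y i)
  *-cauchy x y cx cy ε 0<ε =
    let (A , 0<A , K , x<) = eventually-bounded x cx
        (B , 0<B , L , y<) = eventually-bounded y cy
        (δ , 0<δ , bound)  = *-bound 0<A 0<B ε 0<ε
        (M , p) = cx δ 0<δ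
        (N , q) = cy δ 0<δ
    in (K ⊔ L) ⊔ (M ⊔ N) , λ i j hi hj →
      let (Ki , _ , Mi , Ni) = ⊔₄ K L M N hi
          (_ , Lj , Mj , Nj) = ⊔₄ K L M N hj
      in bound (x i) (x j) (y i) (y j) (x< i Ki) (y< j Lj) (p i j Mi Mj) (q i j Ni Nj)

ℚ→ℝ : ℚ → ℝ
ℚ→ℝ q .seq    i     = q
ℚ→ℝ q .cauchy ε 0<ε = 0 , λ _ _ _ _ → ∣p-p∣ {q} refl 0<ε

infixl 6 _+ᴿ_
infixl 7 _*ᴿ_
infix  8 -ᴿ_

_+ᴿ_ : ℝ → ℝ → ℝ
(x +ᴿ y) .seq    i = seq x i ℚ.+ seq y i
(x +ᴿ y) .cauchy   = +-cauchy (seq x) (seq y) (cauchy x) (cauchy y)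

-ᴿ_ : ℝ → ℝ
(-ᴿ x) .seq    i = ℚ.- seq x i
(-ᴿ x) .cauchy   = neg-cauchy (seq x) (cauchy x)

_*ᴿ_ : ℝ → ℝ → ℝ
(x *ᴿ y) .seq    i = seq x i ℚ.* seq y i
(x *ᴿ y) .cauchy   = *-cauchy (seq x) (seq y) (cauchy x) (cauchy y)

pointwise : ∀ {x y} → (∀ i → seq x i ≡ seq y i) → x ≈ᴿ y
pointwise h = mk≈ᴿ λ ε 0<ε → 0 , λ i _ → ∣p-p∣ (h i) 0<ε

≈ᴿ-refl : ∀ {x} → x ≈ᴿ x
≈ᴿ-refl = pointwise λ _ → refl

≈ᴿ-sym : ∀ {x y} → x ≈ᴿ y → y ≈ᴿ x
≈ᴿ-sym {x} {y} h = mk≈ᴿ λ ε 0<ε → let (N , p) = close h ε 0<ε in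
  N , λ i hi → subst (ℚ._< ε) (∣-∣-swap (seq x i) (seq y i)) (p i hi)

≈ᴿ-trans : ∀ {x y z} → x ≈ᴿ y → y ≈ᴿ z → x ≈ᴿ z
≈ᴿ-trans {x} {y} {z} h k = mk≈ᴿ λ ε 0<ε →
  let (M , p) = close h (½ ℚ.* ε) (0<½* 0<ε)
      (N , q) = close k (½ ℚ.* ε) (0<½* 0<ε)
  in M ⊔ N , λ i hi → trans-bound (seq x i) (seq y i) (seq z i) (p i (⊔ˡ M N hi)) (q i (⊔ʳ M N hi))

+ᴿ-cong : ∀ {x x′ y y′} → x ≈ᴿ x′ → y ≈ᴿ y′ → x +ᴿ y ≈ᴿ x′ +ᴿ y′
+ᴿ-cong {x} {x′} {y} {y′} h k = mk≈ᴿ λ ε 0<ε →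
  let (M , p) = close h (½ ℚ.* ε) (0<½* 0<ε)
      (N , q) = close k (½ ℚ.* ε) (0<½* 0<ε)
  in M ⊔ N , λ i hi →
    +-bound (seq x i) (seq x′ i) (seq y i) (seq y′ i) (p i (⊔ˡ M N hi)) (q i (⊔ʳ M N hi))

-ᴿ-cong : ∀ {x y} → x ≈ᴿ y → -ᴿ x ≈ᴿ -ᴿ y
-ᴿ-cong {x} {y} h = mk≈ᴿ λ ε 0<ε → let (N , p) = close h ε 0<ε in
  N , λ i hi → neg-bound (seq x i) (seq y i) (p i hi)

*ᴿ-cong : ∀ {x x′ y y′} → x ≈ᴿ x′ → y ≈ᴿ y′ → x *ᴿ y ≈ᴿ x′ *ᴿ y′
*ᴿ-cong {x} {x′} {y} {y′} h k = mk≈ᴿ λ ε 0<ε →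
  let (A , 0<A , K , x<)  = eventually-bounded (seq x) (cauchy x)
      (B , 0<B , L , y′<) = eventually-bounded (seq y′) (cauchy y′)
      (δ , 0<δ , bound)   = *-bound 0<A 0<B ε 0<ε
      (M , p) = close h δ 0<δ
      (N , q) = close k δ 0<δ
  in (K ⊔ L) ⊔ (M ⊔ N) , λ i hi →
    let (Ki , Li , Mi , Ni) = ⊔₄ K L M N hi
    in bound (seq x i) (seq x′ i) (seq y i) (seq y′ i) (x< i Ki) (y′< i Li) (p i Mi) (q i Ni)

------------------------------------------------------------------------
-- Complex numbers

infix 4 _≈_
infixl 6 _+_
infixl 7 _*_
infix  8 -_

record ℂ : Set where
  no-eta-equality
  field
    re im : ℝ

open ℂ public

record _≈_ (z w : ℂ) : Set where
  constructor mk≈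
  field
    re≈ : re z ≈ᴿ re w
    im≈ : im z ≈ᴿ im w

open _≈_ public

_+_ : ℂ → ℂ → ℂ
(z + w) .re = re z +ᴿ re w
(z + w) .im = im z +ᴿ im w

-_ : ℂ → ℂ
(- z) .re = -ᴿ re z
(- z) .im = -ᴿ im z

_*_ : ℂ → ℂ → ℂ
(z * w) .re = re z *ᴿ re w +ᴿ -ᴿ (im z *ᴿ im w)
(z * w) .im = re z *ᴿ im w +ᴿ im z *ᴿ re w

ℚ→ℂ : ℚ → ℂ
ℚ→ℂ q .re = ℚ→ℝ q
ℚ→ℂ q .im = ℚ→ℝ 0ℚ

ℕ→ℂ : ℕ → ℂ
ℕ→ℂ n = ℚ→ℂ (+ n / 1)

0ℂ 1ℂ : ℂ
0ℂ = ℚ→ℂ 0ℚ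
1ℂ = ℚ→ℂ 1ℚ

private
  pw : ∀ {z w} → (∀ i → seq (re z) i ≡ seq (re w) i) → (∀ i → seq (im z) i ≡ seq (im w) i) → z ≈ w
  pw h k = mk≈ (pointwise h) (pointwise k)

  ℂ-isEquivalence : IsEquivalence _≈_
  ℂ-isEquivalence = record
    { refl  = mk≈ ≈ᴿ-refl ≈ᴿ-refl
    ; sym   = λ h → mk≈ (≈ᴿ-sym (re≈ h)) (≈ᴿ-sym (im≈ h))
    ; trans = λ h k → mk≈ (≈ᴿ-trans (re≈ h) (re≈ k)) (≈ᴿ-trans (im≈ h) (im≈ k))
    }

  ℂ-+-cong : ∀ {z z′ w w′} → z ≈ z′ → w ≈ w′ → z + w ≈ z′ + w′
  ℂ-+-cong h k = mk≈ (+ᴿ-cong (re≈ h) (re≈ k)) (+ᴿ-cong (im≈ h) (im≈ k))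

  ℂ-*-cong : ∀ {z z′ w w′} → z ≈ z′ → w ≈ w′ → z * w ≈ z′ * w′
  ℂ-*-cong h k = mk≈
    (+ᴿ-cong (*ᴿ-cong (re≈ h) (re≈ k)) (-ᴿ-cong (*ᴿ-cong (im≈ h) (im≈ k))))
    (+ᴿ-cong (*ᴿ-cong (re≈ h) (im≈ k)) (*ᴿ-cong (im≈ h) (re≈ k)))

  module _ where
    open +-*-Solver

    ℂ-*-assoc : ∀ z w v → (z * w) * v ≈ z * (w * v)
    ℂ-*-assoc z w v = pw
      (λ i → solve 6 (λ a b c d e f →
         (a :* c :+ :- (b :* d)) :* e :+ :- ((a :* d :+ b :* c) :* f)
           := a :* (c :* e :+ :- (d :* f)) :+ :- (b :* (c :* f :+ d :* e))) refl
         (seq (re z) i) (seq (im z) i) (seq (re w) i) (seq (im w) i) (seq (re v) i) (seq (im v) i))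
      (λ i → solve 6 (λ a b c d e f →
         (a :* c :+ :- (b :* d)) :* f :+ (a :* d :+ b :* c) :* e
           := a :* (c :* f :+ d :* e) :+ b :* (c :* e :+ :- (d :* f))) refl
         (seq (re z) i) (seq (im z) i) (seq (re w) i) (seq (im w) i) (seq (re v) i) (seq (im v) i))

    ℂ-*-comm : ∀ z w → z * w ≈ w * z
    ℂ-*-comm z w = pw
      (λ i → solve 4 (λ a b c d → a :* c :+ :- (b :* d) := c :* a :+ :- (d :* b)) refl
         (seq (re z) i) (seq (im z) i) (seq (re w) i) (seq (im w) i))
      (λ i → solve 4 (λ a b c d → a :* d :+ b :* c := c :* b :+ d :* a) refl
         (seq (re z) i) (seq (im z) i) (seq (re w) i) (seq (im w) i))

    ℂ-*-identityˡ : ∀ z → 1ℂ * z ≈ z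
    ℂ-*-identityˡ z = pw
      (λ i → solve 2 (λ a b → con 1ℚ :* a :+ :- (con 0ℚ :* b) := a) refl
         (seq (re z) i) (seq (im z) i))
      (λ i → solve 2 (λ a b → con 1ℚ :* b :+ con 0ℚ :* a := b) refl
         (seq (re z) i) (seq (im z) i))

    ℂ-*-distribˡ-+ : ∀ z w v → z * (w + v) ≈ z * w + z * v
    ℂ-*-distribˡ-+ z w v = pw
      (λ i → solve 6 (λ a b c d e f →
         a :* (c :+ e) :+ :- (b :* (d :+ f))
           := (a :* c :+ :- (b :* d)) :+ (a :* e :+ :- (b :* f))) refl
         (seq (re z) i) (seq (im z) i) (seq (re w) i) (seq (im w) i) (seq (re v) i) (seq (im v) i))
      (λ i → solve 6 (λ a b c d e f →
         a :* (d :+ f) :+ b :* (c :+ e)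
           := (a :* d :+ b :* c) :+ (a :* f :+ b :* e)) refl
         (seq (re z) i) (seq (im z) i) (seq (re w) i) (seq (im w) i) (seq (re v) i) (seq (im v) i))

  open IsEquivalence ℂ-isEquivalence using () renaming (trans to ≈-trans)

  ℂ-isCommutativeRing : IsCommutativeRing _≈_ _+_ _*_ -_ 0ℂ 1ℂ
  ℂ-isCommutativeRing = record
    { isRing = record
      { +-isAbelianGroup = record
        { isGroup = record
          { isMonoid = record
            { isSemigroup = record
              { isMagma = record { isEquivalence = ℂ-isEquivalence ; ∙-cong = ℂ-+-cong }
              ; assoc = λ z w v → pw (λ i → ℚₚ.+-assoc (seq (re z) i) (seq (re w) i) (seq (re v) i))
                   (λ i → ℚₚ.+-assoc (seq (im z) i) (seq (im w) i) (seq (im v) i))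
              }
            ; identity = (λ z → pw (λ i → ℚₚ.+-identityˡ (seq (re z) i))
                            (λ i → ℚₚ.+-identityˡ (seq (im z) i)))
                       , (λ z → pw (λ i → ℚₚ.+-identityʳ (seq (re z) i))
                            (λ i → ℚₚ.+-identityʳ (seq (im z) i)))
            }
          ; inverse = (λ z → pw (λ i → ℚₚ.+-inverseˡ (seq (re z) i))
                            (λ i → ℚₚ.+-inverseˡ (seq (im z) i)))
                    , (λ z → pw (λ i → ℚₚ.+-inverseʳ (seq (re z) i))
                            (λ i → ℚₚ.+-inverseʳ (seq (im z) i)))
          ; ⁻¹-cong = λ h → mk≈ (-ᴿ-cong (re≈ h)) (-ᴿ-cong (im≈ h))
          }
        ; comm = λ z w → pw (λ i → ℚₚ.+-comm (seq (re z) i) (seq (re w) i))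
             (λ i → ℚₚ.+-comm (seq (im z) i) (seq (im w) i))
        }
      ; *-cong = ℂ-*-cong
      ; *-assoc = ℂ-*-assoc
      ; *-identity = ℂ-*-identityˡ , λ z → ≈-trans (ℂ-*-comm z 1ℂ) (ℂ-*-identityˡ z)
      ; distrib = ℂ-*-distribˡ-+ , λ z w v → ≈-trans (ℂ-*-comm (w + v) z)
          (≈-trans (ℂ-*-distribˡ-+ z w v) (ℂ-+-cong (ℂ-*-comm z w) (ℂ-*-comm z v)))
      }
    ; *-comm = ℂ-*-comm
    }

ℂ-commutativeRing : CommutativeRing 0ℓ 0ℓ
ℂ-commutativeRing = record { isCommutativeRing = ℂ-isCommutativeRing }

-- The library power satisfies z ^ 0 = 1 for every z, in particular 0 ^ 0 = 1.
open RawSemiringOps (Semiring.rawSemiring (CommutativeRing.semiring ℂ-commutativeRing)) public using (_^_)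

------------------------------------------------------------------------
-- Finite sums, with both bounds inclusive

∑≤ : ℕ → (ℕ → ℂ) → ℂ
∑≤ n f = RawMonoidOps.sum (CommutativeRing.+-rawMonoid ℂ-commutativeRing) {suc n}
  (λ i → f (toℕ i))

infix 6 ∑≤
syntax ∑≤ n (λ k → t) = ∑[ k ≤ n ] t

∑≤ᵠ : ℕ → (ℕ → ℚ) → ℚ
∑≤ᵠ n f = RawMonoidOps.sum (CommutativeRing.+-rawMonoid ℚₚ.+-*-commutativeRing) {suc n}
  (λ i → f (toℕ i))

------------------------------------------------------------------------
-- Multiple harmonic-like numbers

-- All tuples (k₁ , … , kₘ) with 1 ≤ kᵢ ≤ n; the entry i : Fin n stands for
-- kᵢ = 1 + toℕ i. The bound kᵢ ≤ n is implied by k₁ + ⋯ + kₘ ≤ n.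
tuples : (n m : ℕ) → List (Vec (Fin n) m)
tuples n zero    = List.[ [] ]
tuples n (suc m) = cartesianProductWith _∷_ (allFin n) (tuples n m)

parts : ∀ {n m} → Vec (Fin n) m → Vec ℕ m
parts = Vec.map (λ i → suc (toℕ i))

total : ∀ {n m} → Vec (Fin n) m → ℕ
total v = Vec.sum (parts v)

denominator : ∀ {n m} → Vec (Fin n) m → ℕ
denominator v = Vec.foldr (λ _ → ℕ) ℕ._*_ 1 (parts v)

denominator≢0 : ∀ {n m} (v : Vec (Fin n) m) → ℕ.NonZero (denominator v)
denominator≢0 []      = _
denominator≢0 (i ∷ v) = ℕₚ.m*n≢0 (suc (toℕ i)) (denominator v) {{_}} {{denominator≢0 v}}

reciprocal : ∀ {n m} → Vec (Fin n) m → ℚ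
reciprocal v = (1ℤ / denominator v) {{denominator≢0 v}}

H : ℕ → ℕ → ℚ
H n zero      = 1ℚ
H n m@(suc _) = List.foldr ℚ._+_ 0ℚ (List.map reciprocal
  (filter (λ v → (1 ℕₚ.≤? total v) ×-dec (total v ℕₚ.≤? n)) (tuples n m)))

H-0 : ∀ m → H 0 (suc m) ≡ 0ℚ
H-0 m = refl

------------------------------------------------------------------------
-- Signed Stirling numbers of the first kind, by their exponential
-- generating function

-- A formal power series is its sequence of coefficients.
PowerSeries : Set
PowerSeries = ℕ → ℚ

1ˢ : PowerSeries
1ˢ zero    = 1ℚ
1ˢ (suc _) = 0ℚ

_*ˢ_ : PowerSeries → PowerSeries → PowerSeries
(f *ˢ g) n = ∑≤ᵠ n (λ k → f k ℚ.* g (n ∸ k))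

_^ˢ_ : PowerSeries → ℕ → PowerSeries
f ^ˢ zero  = 1ˢ
f ^ˢ suc k = f *ˢ (f ^ˢ k)

-- ln (1 + z) = z - z²/2 + z³/3 - ⋯
ln[1+z] : PowerSeries
ln[1+z] zero    = 0ℚ
ln[1+z] (suc n) = (-1ℤ ℤ.^ n) / suc n

infixl 7 _!/_!

_!/_! : ℕ → ℕ → ℚ
p !/ q ! = (+ (p !) / (q !)) {{q ℕₚ.!≢0}}

-- Comparing coefficients of zⁿ in Σₙ s(n,k) zⁿ/n! = lnᵏ(1+z)/k!.
s : ℕ → ℕ → ℚ
s n k = n !/ k ! ℚ.* (ln[1+z] ^ˢ k) n

private
  sum-0 : ∀ n (f : Fin n → ℚ) → (∀ i → f i ≡ 0ℚ) →
    RawMonoidOps.sum (CommutativeRing.+-rawMonoid ℚₚ.+-*-commutativeRing) f ≡ 0ℚ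
  sum-0 zero    f h = refl
  sum-0 (suc n) f h = cong₂ ℚ._+_ (h Fin.zero) (sum-0 n (λ i → f (Fin.suc i)) (λ i → h (Fin.suc i)))

  ln^-low : ∀ {n k} → n ℕ.< k → (ln[1+z] ^ˢ k) n ≡ 0ℚ
  ln^-low {n} {suc k} (ℕ.s≤s n≤k) = sum-0 (suc n) _ term
    where
    term : ∀ i → ln[1+z] (toℕ i) ℚ.* (ln[1+z] ^ˢ k) (n ∸ toℕ i) ≡ 0ℚ
    term Fin.zero = ℚₚ.*-zeroˡ ((ln[1+z] ^ˢ k) n)
    term i@(Fin.suc j) = trans
      (cong (ln[1+z] (toℕ i) ℚ.*_)
        (ln^-low {n ∸ toℕ i} {k} (ℕₚ.<-≤-trans (ℕₚ.∸-monoʳ-< ℕ.z<s (ℕₚ.≤-pred (toℕ<n i))) n≤k)))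
      (ℚₚ.*-zeroʳ (ln[1+z] (toℕ i)))

s-low : ∀ {n k} → n ℕ.< k → s n k ≡ 0ℚ
s-low {n} {k} n<k = trans (cong (n !/ k ! ℚ.*_) (ln^-low n<k)) (ℚₚ.*-zeroʳ (n !/ k !))

------------------------------------------------------------------------

S : ℕ → ℂ → ℂ → ℕ → ℂ
S n a b m = ∑[ k ≤ n ] (ℕ→ℂ (n C k) * a ^ k * b ^ (n ∸ k) * ℚ→ℂ (H k m))

{-# OPTIONS --safe #-}

-- In terms of generating functions both sides equal (ln (1 − bz) − ln (1 − (a+b)z))ᵐ / (1 − (a+b)z):
-- the left one is the binomial transform F(z) ↦ F(az/(1 − bz))/(1 − bz) of (−ln (1 − z))ᵐ/(1 − z), the
-- right one the binomial expansion of the m-th power. Instead of substituting one series in another, each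
-- side is shown to satisfy the same first-order linear differential equation, whose inhomogeneous term is
-- m times the solution for m − 1, so they agree by induction on m and on the coefficient index.
-- On coefficients the input is (n+1) H_{n+1}(m) = (n+1) H_n(m) + m H_n(m−1), the derivative of
-- (−ln (1 − z))ᵐ, and its analogue for lnⁱ(1 + z).

module Submission where

open import Algebra.Bundles using (CommutativeRing; CommutativeSemiring)
open import Algebra.Definitions using (RightCancellative)
import Algebra.Definitions.RawSemiring as RawSemiringOps
import Algebra.Properties.CommutativeMonoid.Sum as SumProperties
import Algebra.Properties.Group as GroupProperties
import Algebra.Properties.Ring as RingProperties
import Algebra.Properties.Semiring.Mult as MultProperties
import Algebra.Solver.Ring.NaturalCoefficients.Default as SemiringSolver
open import Algebra.Structures.Biased using (isCommutativeMonoidˡ; isCommutativeSemiringˡ)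
open import Data.Bool.Base using (if_then_else_; true; false; _∧_)
open import Data.Fin.Base using (toℕ)
open import Data.Fin.Properties using (toℕ-inject₁; toℕ-fromℕ; toℕ<n)
open import Data.Integer.Base as ℤ using (1ℤ; -1ℤ)
import Data.Integer.Properties as ℤₚ
open import Data.Integer.Solver renaming (module +-*-Solver to ℤSolver)
open import Data.List.Base as List using (List; []; _∷_)
import Data.List.Properties as Listₚ
open import Data.Nat.Base as ℕ using (ℕ; zero; suc; pred; _∸_; s≤s)
open import Data.Nat.Combinatorics using (_C_; nCk+nC[k+1]≡[n+1]C[k+1]; k>n⇒nCk≡0)
import Data.Nat.Properties as ℕₚ
open import Data.Product.Base using (_,_)
open import Data.Rational.Base as ℚ using (ℚ; 0ℚ; 1ℚ; _/_)
import Data.Rational.Properties as ℚₚ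
open import Data.Rational.Unnormalised.Base as ℚᵘ using (mkℚᵘ; *≡*)
import Data.Rational.Unnormalised.Properties as ℚᵘₚ
open import Data.Vec.Base using ([]; _∷_)
open import Function.Base using (_∘_)
open import Level using (_⊔_)
open import Relation.Binary.PropositionalEquality as ≡ using (_≡_)
import Relation.Binary.Reasoning.Setoid as SetoidReasoning
open import Relation.Binary.Structures using (IsEquivalence)
open import Relation.Nullary.Decidable using (Dec; does; _×-dec_)

-- Binomial sums and Pascal's rule.

module BinomialSum {c ℓ} (R : CommutativeSemiring c ℓ) where
  open CommutativeSemiring R
  open SetoidReasoning setoid
  open SumProperties +-commutativeMonoid using (sum; sum-cong-≋; sum-init-last; ∑-distrib-+)
  open MultProperties semiring using (_×_; ×-homo-+)
  open SemiringSolver R using (solve; _:=_; _:+_; _:*_; con)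

  ι : ℕ → Carrier
  ι n = n × 1#

  ∑ : ℕ → (ℕ → Carrier) → Carrier
  ∑ n f = sum {suc n} (λ i → f (toℕ i))

  -- The binomial sum of C(m,j) F(j, m-j) over j, unfolded along Pascal's triangle. In this form
  -- inductions on m meet neither binomial coefficients nor truncated subtraction; `∑-C` translates
  -- back.
  bin : ℕ → (ℕ → ℕ → Carrier) → Carrier
  bin zero    F = F 0 0
  bin (suc m) F = bin m (λ j i → F (suc j) i) + bin m (λ j i → F j (suc i))

  ∑-cong : ∀ n {f g} → (∀ k → k ℕ.≤ n → f k ≈ g k) → ∑ n f ≈ ∑ n g
  ∑-cong n h = sum-cong-≋ (λ i → h (toℕ i) (ℕₚ.≤-pred (toℕ<n i)))

  ∑-+ : ∀ n f g → ∑ n (λ k → f k + g k) ≈ ∑ n f + ∑ n g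
  ∑-+ n f g = ∑-distrib-+ {suc n} (λ i → f (toℕ i)) (λ i → g (toℕ i))

  ∑-last : ∀ n f → ∑ (suc n) f ≈ ∑ n f + f (suc n)
  ∑-last n f = trans (sum-init-last {suc n} (λ i → f (toℕ i)))
    (+-cong (sum-cong-≋ {suc n} (λ i → reflexive (≡.cong f (toℕ-inject₁ i))))
            (reflexive (≡.cong f (toℕ-fromℕ (suc n)))))

  bin-cong : ∀ m {F G} → (∀ j i → F j i ≈ G j i) → bin m F ≈ bin m G
  bin-cong zero    h = h 0 0
  bin-cong (suc m) h = +-cong (bin-cong m (λ j i → h (suc j) i)) (bin-cong m (λ j i → h j (suc i)))

  bin-+ : ∀ m F G → bin m (λ j i → F j i + G j i) ≈ bin m F + bin m G
  bin-+ zero    F G = refl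
  bin-+ (suc m) F G = trans (+-cong (bin-+ m _ _) (bin-+ m _ _))
    (solve 4 (λ a b c d → (a :+ b) :+ (c :+ d) := (a :+ c) :+ (b :+ d)) refl _ _ _ _)

  bin-* : ∀ m r F → bin m (λ j i → r * F j i) ≈ r * bin m F
  bin-* zero    r F = refl
  bin-* (suc m) r F = trans (+-cong (bin-* m r _) (bin-* m r _)) (sym (distribˡ r _ _))

  ι-suc-* : ∀ n x → ι (suc n) * x ≈ ι n * x + x
  ι-suc-* n x = solve 2 (λ k x → (con 1 :+ k) :* x := k :* x :+ x) refl (ι n) x

  -- The absorption identity j C(m,j) = m C(m-1,j-1). The values `pred 0` are harmless, since they
  -- come with the factor `ι 0`.
  bin-absorbˡ : ∀ m F → bin m (λ j i → ι j * F (pred j) i) ≈ ι m * bin (pred m) F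
  bin-absorbˡ zero          F = refl
  bin-absorbˡ (suc zero)    F = trans (+-congˡ (zeroˡ _)) (+-identityʳ _)
  bin-absorbˡ (suc (suc m)) F = begin
    bin (suc m) (λ j i → ι (suc j) * F j i) + bin (suc m) (λ j i → ι j * F (pred j) (suc i))
      ≈⟨ +-cong (trans (bin-cong (suc m) step) (bin-+ (suc m) (λ j i → ι j * F (suc (pred j)) i) F)) (bin-absorbˡ (suc m) _) ⟩
    (bin (suc m) (λ j i → ι j * F (suc (pred j)) i) + bin (suc m) F)
      + ι (suc m) * bin m (λ j i → F j (suc i))
      ≈⟨ +-congʳ (+-congʳ (bin-absorbˡ (suc m) (λ j i → F (suc j) i))) ⟩
    (ι (suc m) * bin m (λ j i → F (suc j) i) + bin (suc m) F)
      + ι (suc m) * bin m (λ j i → F j (suc i))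
      ≈⟨ solve 3 (λ k p q → (k :* p :+ (p :+ q)) :+ k :* q := (con 1 :+ k) :* (p :+ q)) refl (ι (suc m)) _ _ ⟩
    ι (suc (suc m)) * bin (suc m) F ∎
    where
    -- Writing `suc (pred j)` for j gives the term the shape required by the induction hypothesis
    -- for `F (suc j) i`; the two differ only at j = 0, where the factor `ι j` vanishes.
    step : ∀ j i → ι (suc j) * F j i ≈ ι j * F (suc (pred j)) i + F j i
    step zero    i = trans (ι-suc-* 0 _) (+-congʳ (trans (zeroˡ _) (sym (zeroˡ _))))
    step (suc j) i = ι-suc-* (suc j) _

  bin-swap : ∀ m F → bin m (λ j i → F i j) ≈ bin m F
  bin-swap zero    F = refl
  bin-swap (suc m) F = trans (+-cong (bin-swap m _) (bin-swap m _)) (+-comm _ _)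

  bin-absorbʳ : ∀ m F → bin m (λ j i → ι i * F j (pred i)) ≈ ι m * bin (pred m) F
  bin-absorbʳ m F = trans (bin-swap m (λ i j → ι i * F j (pred i)))
    (trans (bin-absorbˡ m (λ i j → F j i)) (*-congˡ (bin-swap (pred m) F)))

  ∑-C : ∀ m F → ∑ m (λ j → ι (m C j) * F j (m ∸ j)) ≈ bin m F
  ∑-C zero    F = trans (+-identityʳ _) (trans (*-congʳ (+-identityʳ _)) (*-identityˡ _))
  ∑-C (suc m) F = begin
    ι (suc m C 0) * F 0 (suc m) + ∑ m (λ j → ι (suc m C suc j) * F (suc j) (m ∸ j))
      ≈⟨ +-congˡ (trans (∑-cong m pascal)
           (∑-+ m (λ j → ι (m C j) * F (suc j) (m ∸ j)) (λ j → ι (m C suc j) * F (suc j) (m ∸ j)))) ⟩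
    ι (suc m C 0) * F 0 (suc m) + (∑ m (λ j → ι (m C j) * F (suc j) (m ∸ j))
      + ∑ m (λ j → ι (m C suc j) * F (suc j) (m ∸ j)))
      -- Since `suc m C 0` and `m C 0` are both 1, the leading term and the last sum form one sum up
      -- to `suc m`. Its top term, with `m C suc m` = 0, is dropped in the next step.
      ≈⟨ solve 3 (λ p q r → p :+ (q :+ r) := q :+ (p :+ r)) refl _ _ _ ⟩
    ∑ m (λ j → ι (m C j) * F (suc j) (m ∸ j))
      + ∑ (suc m) (λ j → ι (m C j) * F j (suc m ∸ j))
      ≈⟨ +-cong (∑-C m (λ j i → F (suc j) i)) (trans (∑-last m (λ j → ι (m C j) * F j (suc m ∸ j))) (trans (+-congˡ top)
           (trans (+-identityʳ _) (∑-cong m shift)))) ⟩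
    bin m (λ j i → F (suc j) i) + ∑ m (λ j → ι (m C j) * F j (suc (m ∸ j)))
      ≈⟨ +-congˡ (∑-C m (λ j i → F j (suc i))) ⟩
    bin (suc m) F ∎
    where
    pascal : ∀ j → j ℕ.≤ m → ι (suc m C suc j) * F (suc j) (m ∸ j)
      ≈ ι (m C j) * F (suc j) (m ∸ j) + ι (m C suc j) * F (suc j) (m ∸ j)
    pascal j _ = trans (*-congʳ (trans
      (reflexive (≡.cong ι (≡.sym (nCk+nC[k+1]≡[n+1]C[k+1] m j)))) (×-homo-+ 1# (m C j) (m C suc j))))
      (distribʳ _ _ _)
    top : ι (m C suc m) * F (suc m) (suc m ∸ suc m) ≈ 0#
    top = trans (*-congʳ (reflexive (≡.cong ι (k>n⇒nCk≡0 (ℕₚ.n<1+n m))))) (zeroˡ _)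
    shift : ∀ j → j ℕ.≤ m → ι (m C j) * F j (suc m ∸ j) ≈ ι (m C j) * F j (suc (m ∸ j))
    shift j j≤m = *-congˡ (reflexive (≡.cong (F j) (ℕₚ.+-∸-assoc 1 j≤m)))

-- Derivations, formal power series and the Euler operator.

record Derivation {c ℓ} (T : CommutativeSemiring c ℓ) : Set (c ⊔ ℓ) where
  open CommutativeSemiring T
  field
    θ      : Carrier → Carrier
    θ-cong : ∀ {f g} → f ≈ g → θ f ≈ θ g
    θ-+    : ∀ f g → θ (f + g) ≈ θ f + θ g
    θ-*    : ∀ f g → θ (f * g) ≈ θ f * g + f * θ g

module PowerSeriesOver {c ℓ} (R : CommutativeRing c ℓ) where
  open CommutativeRing R
  open SetoidReasoning setoid
  open BinomialSum commutativeSemiring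
  open SemiringSolver commutativeSemiring using (solve; _:=_; _:+_; _:*_; con)

  Series : Set c
  Series = ℕ → Carrier

  infix 4 _≋_
  _≋_ : Series → Series → Set ℓ
  f ≋ g = ∀ n → f n ≈ g n

  infixl 6 _⊕_
  infixl 7 _⊛_
  _⊕_ _⊛_ : Series → Series → Series
  (f ⊕ g) n = f n + g n
  (f ⊛ g) n = ∑ n (λ k → f k * g (n ∸ k))

  const mono : Carrier → Series
  const r zero    = r
  const r (suc n) = 0#
  mono r zero    = 0#
  mono r (suc n) = const r n

  ⊛-cong : ∀ {f f′ g g′} → f ≋ f′ → g ≋ g′ → f ⊛ g ≋ f′ ⊛ g′
  ⊛-cong h k n = ∑-cong n (λ i _ → *-cong (h i) (k (n ∸ i)))

  ⊛-distribʳ : ∀ f g h → (f ⊕ g) ⊛ h ≋ (f ⊛ h) ⊕ (g ⊛ h)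
  ⊛-distribʳ f g h n = trans (∑-cong n (λ k _ → distribʳ (h (n ∸ k)) (f k) (g k)))
    (∑-+ n (λ k → f k * h (n ∸ k)) (λ k → g k * h (n ∸ k)))

  zero-⊛ : ∀ g → (λ _ → 0#) ⊛ g ≋ λ _ → 0#
  zero-⊛ g zero    = trans (+-identityʳ _) (zeroˡ _)
  zero-⊛ g (suc n) = trans (+-cong (zeroˡ _) (zero-⊛ g n)) (+-identityʳ _)

  scale-⊛ : ∀ r f g n → ((λ k → r * f k) ⊛ g) n ≈ r * (f ⊛ g) n
  scale-⊛ r f g zero    = solve 3 (λ r a b → (r :* a) :* b :+ con 0 := r :* (a :* b :+ con 0)) refl r _ _
  scale-⊛ r f g (suc n) = trans (+-cong (*-assoc _ _ _) (scale-⊛ r (f ∘ suc) g n)) (sym (distribˡ r _ _))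

  const-⊛ : ∀ r g n → (const r ⊛ g) n ≈ r * g n
  const-⊛ r g zero    = +-identityʳ _
  const-⊛ r g (suc n) = trans (+-congˡ (zero-⊛ g n)) (+-identityʳ _)

  mono-⊛-zero : ∀ r g → (mono r ⊛ g) 0 ≈ 0#
  mono-⊛-zero r g = trans (+-identityʳ _) (zeroˡ _)

  mono-⊛-suc : ∀ r g n → (mono r ⊛ g) (suc n) ≈ r * g n
  mono-⊛-suc r g n = trans (+-cong (zeroˡ _) (const-⊛ r g n)) (+-identityˡ _)

  -- Induction on the index: by computation, the tail of `f ⊛ g` is `f 0` times the tail of `g`,
  -- plus the product of the tail of `f` with `g`.
  ⊛-assoc : ∀ f g h → (f ⊛ g) ⊛ h ≋ f ⊛ (g ⊛ h)
  ⊛-assoc f g h zero    = solve 3 (λ a b c → (a :* b :+ con 0) :* c :+ con 0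
    := a :* (b :* c :+ con 0) :+ con 0) refl _ _ _
  ⊛-assoc f g h (suc n) = begin
    (f 0 * g 0 + 0#) * h (suc n) + ((f ⊛ g) ∘ suc ⊛ h) n
      ≈⟨ +-congˡ (trans (⊛-distribʳ (λ k → f 0 * g (suc k)) ((f ∘ suc) ⊛ g) h n)
           (+-cong (scale-⊛ (f 0) (g ∘ suc) h n) (⊛-assoc (f ∘ suc) g h n))) ⟩
    (f 0 * g 0 + 0#) * h (suc n) + (f 0 * ((g ∘ suc) ⊛ h) n + ((f ∘ suc) ⊛ (g ⊛ h)) n)
      ≈⟨ solve 5 (λ a b c d e → (a :* b :+ con 0) :* c :+ (a :* d :+ e)
           := a :* (b :* c :+ d) :+ e) refl (f 0) (g 0) (h (suc n)) _ _ ⟩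
    (f ⊛ (g ⊛ h)) (suc n) ∎

  -- Computation peels off the term with `f 0`; here the term with `g 0` is peeled off instead.
  -- Commutativity follows by comparing the two.
  ⊛-suc : ∀ f g n → (f ⊛ g) (suc n) ≈ f (suc n) * g 0 + (f ⊛ (g ∘ suc)) n
  ⊛-suc f g zero    = solve 4 (λ a b c d → a :* b :+ (c :* d :+ con 0) := c :* d :+ (a :* b :+ con 0)) refl _ _ _ _
  ⊛-suc f g (suc n) = trans (+-congˡ (⊛-suc (f ∘ suc) g n))
    (solve 3 (λ a b c → a :+ (b :+ c) := b :+ (a :+ c)) refl _ _ _)

  ⊛-comm : ∀ f g → f ⊛ g ≋ g ⊛ f
  ⊛-comm f g zero    = +-congʳ (*-comm _ _)
  ⊛-comm f g (suc n) = trans (⊛-suc f g n) (+-cong (*-comm _ _) (⊛-comm f (g ∘ suc) n))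

  ≋-isEquivalence : IsEquivalence _≋_
  ≋-isEquivalence = record
    { refl  = λ _ → refl
    ; sym   = λ h n → sym (h n)
    ; trans = λ h k n → trans (h n) (k n)
    }

  -- Only the semiring structure is built: the differential equations below are arranged without
  -- subtraction, and cancellation of summands replaces it.
  seriesSemiring : CommutativeSemiring c ℓ
  seriesSemiring = record
    { Carrier = Series
    ; _≈_     = _≋_
    ; _+_     = _⊕_
    ; _*_     = _⊛_
    ; 0#      = λ _ → 0#
    ; 1#      = const 1#
    ; isCommutativeSemiring = isCommutativeSemiringˡ record
      { +-isCommutativeMonoid = record
        { isMonoid = record
          { isSemigroup = record
            { isMagma = record
              { isEquivalence = ≋-isEquivalence
              ; ∙-cong = λ h k n → +-cong (h n) (k n)
              }
            ; assoc = λ f g h n → +-assoc (f n) (g n) (h n)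
            }
          ; identity = (λ f n → +-identityˡ (f n)) , (λ f n → +-identityʳ (f n))
          }
        ; comm = λ f g n → +-comm (f n) (g n)
        }
      ; *-isCommutativeMonoid = isCommutativeMonoidˡ record
        { isSemigroup = record
          { isMagma = record
            { isEquivalence = ≋-isEquivalence
            ; ∙-cong = ⊛-cong
            }
          ; assoc = ⊛-assoc
          }
        ; identityˡ = λ f n → trans (const-⊛ 1# f n) (*-identityˡ (f n))
        ; comm = ⊛-comm
        }
      ; distribʳ = λ f g h → ⊛-distribʳ g h f
      ; zeroˡ = zero-⊛
      }
    }

  module S = BinomialSum seriesSemiring

  ⊕-cancelʳ : ∀ h f g → f ⊕ h ≋ g ⊕ h → f ≋ g
  ⊕-cancelʳ h f g eq n = GroupProperties.∙-cancelʳ +-group (h n) (f n) (g n) (eq n)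

  ι-⊛ : ∀ m f n → (S.ι m ⊛ f) n ≈ ι m * f n
  ι-⊛ zero    f n = trans (zero-⊛ f n) (sym (zeroˡ _))
  ι-⊛ (suc m) f n = trans (⊛-distribʳ (const 1#) (S.ι m) f n)
    (trans (+-cong (const-⊛ 1# f n) (ι-⊛ m f n)) (sym (distribʳ _ _ _)))

  bin-coefficient : ∀ m F n → S.bin m F n ≈ bin m (λ j i → F j i n)
  bin-coefficient zero    F n = refl
  bin-coefficient (suc m) F n = +-cong (bin-coefficient m _ n) (bin-coefficient m _ n)

  -- The Euler operator z d/dz. It keeps the index fixed, and rz is its own image (`θ-mono`).
  θ : Series → Series
  θ f n = ι n * f n

  θ-cong : ∀ {f g} → f ≋ g → θ f ≋ θ g
  θ-cong h n = *-congˡ (h n)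

  θ-⊕ : ∀ f g → θ (f ⊕ g) ≋ θ f ⊕ θ g
  θ-⊕ f g n = distribˡ _ _ _

  θ-const : ∀ r → θ (const r) ≋ λ _ → 0#
  θ-const r zero    = zeroˡ r
  θ-const r (suc n) = zeroʳ _

  θ-mono : ∀ r → θ (mono r) ≋ mono r
  θ-mono r zero          = zeroˡ _
  θ-mono r (suc zero)    = trans (*-congʳ (+-identityʳ _)) (*-identityˡ _)
  θ-mono r (suc (suc n)) = zeroʳ _

  -- The Leibniz rule holds because n = k + (n - k) in each term of the convolution; the induction
  -- distributes one unit of n at a time.
  θ-⊛ : ∀ f g → θ (f ⊛ g) ≋ θ f ⊛ g ⊕ f ⊛ θ g
  θ-⊛ f g zero = solve 2 (λ a b → con 0 :* (a :* b :+ con 0)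
    := ((con 0 :* a) :* b :+ con 0) :+ (a :* (con 0 :* b) :+ con 0)) refl _ _
  θ-⊛ f g (suc n) = begin
    ι (suc n) * (f 0 * g (suc n) + p)
      ≈⟨ solve 4 (λ k a b p → (con 1 :+ k) :* (a :* b :+ p)
           := (a :* ((con 1 :+ k) :* b) :+ p) :+ k :* p) refl (ι n) (f 0) (g (suc n)) p ⟩
    (f 0 * (ι (suc n) * g (suc n)) + p) + ι n * p
      ≈⟨ +-congˡ (θ-⊛ (f ∘ suc) g n) ⟩
    (f 0 * (ι (suc n) * g (suc n)) + p) + ((θ (f ∘ suc) ⊛ g) n + ((f ∘ suc) ⊛ θ g) n)
      ≈⟨ solve 6 (λ a b p q r d → (a :* b :+ p) :+ (q :+ r) := ((con 0 :* a) :* d :+ (q :+ p)) :+ (a :* b :+ r)) refl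
           (f 0) _ p _ _ (g (suc n)) ⟩
    ((0# * f 0) * g (suc n) + ((θ (f ∘ suc) ⊛ g) n + p)) + (f 0 * (ι (suc n) * g (suc n)) + ((f ∘ suc) ⊛ θ g) n)
      -- Shifting the index costs one copy of the series: the tail of `θ f` is
      -- `θ (f ∘ suc) ⊕ (f ∘ suc)`.
      ≈⟨ +-congʳ (+-congˡ (trans (sym (⊛-distribʳ (θ (f ∘ suc)) (f ∘ suc) g n))
           (⊛-cong {g = g} (λ k → sym (ι-suc-* k (f (suc k)))) (λ _ → refl) n))) ⟩
    (θ f ⊛ g ⊕ f ⊛ θ g) (suc n) ∎
    where p = ((f ∘ suc) ⊛ g) n

  θ-derivation : Derivation seriesSemiring
  θ-derivation = record { θ = θ ; θ-cong = θ-cong ; θ-+ = θ-⊕ ; θ-* = θ-⊛ }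

-- Linear differential equations in a commutative semiring with a derivation.

module DifferentialSemiring {c ℓ} (T : CommutativeSemiring c ℓ)
  (+-cancelʳ : RightCancellative (CommutativeSemiring._≈_ T) (CommutativeSemiring._+_ T))
  (derivation : Derivation T)
  (y w : CommutativeSemiring.Carrier T)
  where
  open CommutativeSemiring T
  open Derivation derivation
  open BinomialSum T
  open SetoidReasoning setoid
  open SemiringSolver T using (solve; _:=_; _:+_; _:*_; con)

  -- For y = γz, w = βz and θ = z d/dz this is (1 + w) (θ F − y (θ F + F)) = (y + w) K, the
  -- equation of F = (ln (1 + βz) − ln (1 − γz))ᵐ / (1 − γz) when K is m times the same
  -- expression for m − 1, arranged so that no subtraction occurs.
  Equation : Carrier → Carrier → Set ℓ
  Equation F K = θ F + w * θ F ≈ (d + w * d) + (y + w) * K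
    where d = y * (θ F + F)

  -- The inhomogeneous term (y + w) K is common to both equations, so it can be traded between them;
  -- then the factor 1 + w divides out. What remains is the homogeneous equation of F - G, with
  -- negative terms moved across.
  Equation-difference : (∀ f g → f + w * f ≈ g + w * g → f ≈ g) →
    ∀ {F G K} → Equation F K → Equation G K → θ F + y * (θ G + G) ≈ θ G + y * (θ F + F)
  Equation-difference cancel {F} {G} {K} eF eG = cancel _ _ (begin
    (θ F + dG) + w * (θ F + dG)
      ≈⟨ solve 3 (λ w f g → (f :+ g) :+ w :* (f :+ g) := (f :+ w :* f) :+ (g :+ w :* g)) refl w (θ F) dG ⟩
    (θ F + w * θ F) + (dG + w * dG)
      ≈⟨ +-congʳ eF ⟩
    ((dF + w * dF) + (y + w) * K) + (dG + w * dG)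
      ≈⟨ solve 3 (λ f k g → (f :+ k) :+ g := (g :+ k) :+ f) refl (dF + w * dF) ((y + w) * K) (dG + w * dG) ⟩
    ((dG + w * dG) + (y + w) * K) + (dF + w * dF)
      ≈⟨ +-congʳ (sym eG) ⟩
    (θ G + w * θ G) + (dF + w * dF)
      ≈⟨ solve 3 (λ w f g → (f :+ w :* f) :+ (g :+ w :* g) := (f :+ g) :+ w :* (f :+ g)) refl w (θ G) dF ⟩
    (θ G + dF) + w * (θ G + dF) ∎)
    where
    dF = y * (θ F + F)
    dG = y * (θ G + G)

  -- For U the transform of f, v = U − bzU − f(0) and θ v is the transform of θ f.
  transform-equation : θ w ≈ w → ∀ U K e v → θ e ≈ 0# → U + w * U ≈ e + v →
    θ v + w * θ v ≈ (y + w) * ((θ v + U) + K) → Equation U K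
  transform-equation θw U K e v θe hU hv = +-cancelʳ (w * U) _ _ (begin
    (θ U + w * θ U) + w * U
      ≈⟨ τ≈ ⟨
    τ
      -- Both sides of `hv` contain w τ. Cancelling it leaves τ = y τ + (y + w)(U + K), into which
      -- the expression `τ≈` for τ is substituted.
      ≈⟨ +-cancelʳ (w * τ) _ _ (trans hv (solve 5 (λ y w t u k → (y :+ w) :* ((t :+ u) :+ k)
           := (y :* t :+ (y :+ w) :* (u :+ k)) :+ w :* t) refl y w τ U K)) ⟩
    y * τ + (y + w) * (U + K)
      ≈⟨ +-congʳ (*-congˡ τ≈) ⟩
    y * ((θ U + w * θ U) + w * U) + (y + w) * (U + K)
      ≈⟨ solve 5 (λ y w t u k → y :* ((t :+ w :* t) :+ w :* u) :+ (y :+ w) :* (u :+ k)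
           := ((y :* (t :+ u) :+ w :* (y :* (t :+ u))) :+ (y :+ w) :* k) :+ w :* u) refl y w (θ U) U K ⟩
    _ ∎)
    where
    τ = θ v
    τ≈ : τ ≈ (θ U + w * θ U) + w * U
    τ≈ = begin
      θ v                        ≈⟨ +-identityˡ _ ⟨
      0# + θ v                   ≈⟨ +-congʳ θe ⟨
      θ e + θ v                  ≈⟨ θ-+ e v ⟨
      θ (e + v)                  ≈⟨ θ-cong hU ⟨
      θ (U + w * U)              ≈⟨ trans (θ-+ U (w * U)) (+-congˡ (θ-* w U)) ⟩
      θ U + (θ w * U + w * θ U)  ≈⟨ +-congˡ (+-congʳ (*-congʳ θw)) ⟩
      θ U + (w * U + w * θ U)    ≈⟨ solve 3 (λ a b c → a :+ (b :+ c) := (a :+ c) :+ b) refl _ _ _ ⟩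
      (θ U + w * θ U) + w * U    ∎

  bin-θ : ∀ m F → bin m (λ j i → θ (F j i)) ≈ θ (bin m F)
  bin-θ zero    F = refl
  bin-θ (suc m) F = trans (+-cong (bin-θ m _) (bin-θ m _)) (sym (θ-+ _ _))

  -- This is (1 + w)(A - y (A + B)) = (1 + w) y Z′ + (1 - y) w Z with negative terms moved across.
  -- `A` stands for the derivative of `B`; as a variable of its own it makes the relation linear in
  -- all four arguments, so that it passes to binomial sums.
  ProductEquation : (A B Z Z′ : Carrier) → Set ℓ
  ProductEquation A B Z Z′ =
    (A + w * A) + y * (w * Z) ≈ ((y * (A + B) + w * (y * (A + B))) + (y * Z′ + w * (y * Z′))) + w * Z

  -- By the Leibniz rule, (1 + w)(1 - y) θ(pq) splits into (1 + w) q · (1 - y) θ p and (1 - y) p ·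
  -- (1 + w) θ q, and each hypothesis evaluates one of the two.
  product-equation : ∀ p p′ q q′ → θ p ≈ y * (θ p + p) + y * p′ → θ q + w * θ q ≈ w * q′ →
    ProductEquation (θ (p * q)) (p * q) (p * q′) (p′ * q)
  product-equation p p′ q q′ hp hq = begin
    (θ (p * q) + w * θ (p * q)) + y * (w * (p * q′))
      ≈⟨ +-congʳ (+-cong (θ-* p q) (*-congˡ (θ-* p q))) ⟩
    (D + w * D) + y * (w * (p * q′))
      ≈⟨ solve 7 (λ y w p q q′ tp tq → let d = tp :* q :+ p :* tq in
           (d :+ w :* d) :+ y :* (w :* (p :* q′))
           := ((tp :* q :+ w :* (tp :* q)) :+ p :* (tq :+ w :* tq)) :+ (y :* p) :* (w :* q′)) refl
           y w p q q′ (θ p) (θ q) ⟩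
    ((θ p * q + w * (θ p * q)) + p * (θ q + w * θ q)) + (y * p) * (w * q′)
      -- `hq` is used in both directions: forwards in the term with p, and backwards in the term
      -- with y p, where the restored θ q completes y θ p q to y θ(pq).
      ≈⟨ +-cong (+-cong (+-cong (*-congʳ hp) (*-congˡ (*-congʳ hp))) (*-congˡ hq))
           (*-congˡ (sym hq)) ⟩
    ((X * q + w * (X * q)) + p * (w * q′)) + (y * p) * (θ q + w * θ q)
      ≈⟨ solve 8 (λ y w p p′ q q′ tp tq → let d = tp :* q :+ p :* tq ; x = y :* (tp :+ p) :+ y :* p′ in
           ((x :* q :+ w :* (x :* q)) :+ p :* (w :* q′)) :+ (y :* p) :* (tq :+ w :* tq)
           := ((y :* (d :+ p :* q) :+ w :* (y :* (d :+ p :* q))) :+ (y :* (p′ :* q) :+ w :* (y :* (p′ :* q)))) :+ w :* (p :* q′)) refl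
           y w p p′ q q′ (θ p) (θ q) ⟩
    ((y * (D + p * q) + w * (y * (D + p * q))) + (y * (p′ * q) + w * (y * (p′ * q)))) + w * (p * q′)
      ≈⟨ +-congʳ (+-congʳ (+-cong (*-congˡ (+-congʳ (sym (θ-* p q))))
           (*-congˡ (*-congˡ (+-congʳ (sym (θ-* p q))))))) ⟩
    _ ∎
    where
    D = θ p * q + p * θ q
    X = y * (θ p + p) + y * p′

  ProductEquation-+ : ∀ A A₁ B B₁ Z Z₁ Z′ Z′₁ → ProductEquation A B Z Z′ → ProductEquation A₁ B₁ Z₁ Z′₁ →
    ProductEquation (A + A₁) (B + B₁) (Z + Z₁) (Z′ + Z′₁)
  ProductEquation-+ A A₁ B B₁ Z Z₁ Z′ Z′₁ e e₁ = begin
    _ ≈⟨ solve 6 (λ y w a a₁ z z₁ → ((a :+ a₁) :+ w :* (a :+ a₁)) :+ y :* (w :* (z :+ z₁))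
           := ((a :+ w :* a) :+ y :* (w :* z)) :+ ((a₁ :+ w :* a₁) :+ y :* (w :* z₁))) refl y w A A₁ Z Z₁ ⟩
    _ ≈⟨ +-cong e e₁ ⟩
    _ ≈⟨ solve 10 (λ y w a a₁ b b₁ z z₁ v v₁ →
           (((y :* (a :+ b) :+ w :* (y :* (a :+ b))) :+ (y :* v :+ w :* (y :* v))) :+ w :* z)
           :+ (((y :* (a₁ :+ b₁) :+ w :* (y :* (a₁ :+ b₁))) :+ (y :* v₁ :+ w :* (y :* v₁))) :+ w :* z₁)
           := ((y :* ((a :+ a₁) :+ (b :+ b₁)) :+ w :* (y :* ((a :+ a₁) :+ (b :+ b₁))))
               :+ (y :* (v :+ v₁) :+ w :* (y :* (v :+ v₁)))) :+ w :* (z :+ z₁)) refl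
           y w A A₁ B B₁ Z Z₁ Z′ Z′₁ ⟩
    _ ∎

  ProductEquation-bin : ∀ m A B Z Z′ → (∀ j i → ProductEquation (A j i) (B j i) (Z j i) (Z′ j i)) →
    ProductEquation (bin m A) (bin m B) (bin m Z) (bin m Z′)
  ProductEquation-bin zero    A B Z Z′ h = h 0 0
  ProductEquation-bin (suc m) A B Z Z′ h = ProductEquation-+ _ _ _ _ _ _ _ _
    (ProductEquation-bin m _ _ _ _ (λ j i → h (suc j) i)) (ProductEquation-bin m _ _ _ _ (λ j i → h j (suc i)))

  -- When Z and Z′ coincide, the coefficients combine to (1 + w) y + (1 - y) w = y + w. The product
  -- y w K, present on both sides, is cancelled.
  ProductEquation⇒Equation : ∀ F A Z Z′ K → A ≈ θ F → Z ≈ K → Z′ ≈ K →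
    ProductEquation A F Z Z′ → Equation F K
  ProductEquation⇒Equation F A Z Z′ K hA hZ hZ′ e = +-cancelʳ (y * (w * K)) _ _ (begin
    (θ F + w * θ F) + y * (w * K)
      ≈⟨ sym (+-cong (+-cong hA (*-congˡ hA)) (*-congˡ (*-congˡ hZ))) ⟩
    (A + w * A) + y * (w * Z)
      ≈⟨ e ⟩
    _ ≈⟨ +-cong (+-cong (+-cong (*-congˡ (+-congʳ hA)) (*-congˡ (*-congˡ (+-congʳ hA))))
           (+-cong (*-congˡ hZ′) (*-congˡ (*-congˡ hZ′)))) (*-congˡ hZ) ⟩
    ((d + w * d) + (y * K + w * (y * K))) + w * K
      ≈⟨ solve 4 (λ y w d k → ((d :+ w :* d) :+ (y :* k :+ w :* (y :* k))) :+ w :* k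
           := ((d :+ w :* d) :+ (y :+ w) :* k) :+ y :* (w :* k)) refl y w d K ⟩
    ((d + w * d) + (y + w) * K) + y * (w * K) ∎)
    where d = y * (θ F + F)

  -- Lowering the index of `P` and lowering that of `Q` give the same sum: by absorption on the left
  -- and on the right, both equal m times the binomial sum for m - 1. Hence Z and Z′ coincide after
  -- summation, though not term by term.
  bin-product-equation : (P Q : ℕ → Carrier) →
    (∀ j → θ (P j) ≈ y * (θ (P j) + P j) + y * (ι j * P (pred j))) →
    (∀ i → θ (Q i) + w * θ (Q i) ≈ w * (ι i * Q (pred i))) →
    ∀ m → Equation (bin m (λ j i → P j * Q i)) (ι m * bin (pred m) (λ j i → P j * Q i))
  bin-product-equation P Q hP hQ m = ProductEquation⇒Equation _ _ _ _ _
    (bin-θ m _)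
    (trans (bin-cong m (λ j i → solve 3 (λ p k q → p :* (k :* q) := k :* (p :* q)) refl (P j) (ι i) (Q (pred i))))
      (bin-absorbʳ m (λ j i → P j * Q i)))
    (trans (bin-cong m (λ j i → *-assoc (ι j) (P (pred j)) (Q i)))
      (bin-absorbˡ m (λ j i → P j * Q i)))
    (ProductEquation-bin m _ _ _ _ (λ j i →
      product-equation (P j) (ι j * P (pred j)) (Q i) (ι i * Q (pred i)) (hP j) (hQ i)))

  -- Modelled on l = -ln(1 - y), for which (1 - y) θ l = y, and L j = lʲ/(1 - y). In the Leibniz
  -- expansion of θ(l · L j) the factor θ l supplies one further copy of y L j, which raises the
  -- multiple j to j + 1.
  log-power-over-1-y : ∀ l (L : ℕ → Carrier) → θ l ≈ y * θ l + y → θ (L 0) ≈ y * (θ (L 0) + L 0) →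
    (∀ j → L (suc j) ≈ l * L j) →
    ∀ j → θ (L j) ≈ y * (θ (L j) + L j) + y * (ι j * L (pred j))
  log-power-over-1-y l L hl h₀ hL zero    = trans h₀ (sym (trans
    (+-congˡ (trans (*-congˡ (zeroˡ _)) (zeroʳ _))) (+-identityʳ _)))
  log-power-over-1-y l L hl h₀ hL (suc j) = begin
    θ (L (suc j))
      ≈⟨ θL ⟩
    θ l * L j + l * θ (L j)
      ≈⟨ +-cong (*-congʳ hl) (*-congˡ (log-power-over-1-y l L hl h₀ hL j)) ⟩
    (y * θ l + y) * L j + l * (y * (θ (L j) + L j) + y * (ι j * L (pred j)))
      ≈⟨ solve 7 (λ y tl l L tL k L′ → (y :* tl :+ y) :* L :+ l :* (y :* (tL :+ L) :+ y :* (k :* L′))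
           := (y :* ((tl :* L :+ l :* tL) :+ l :* L) :+ y :* L) :+ y :* (k :* (l :* L′))) refl
           y (θ l) l (L j) (θ (L j)) (ι j) (L (pred j)) ⟩
    (y * ((θ l * L j + l * θ (L j)) + l * L j) + y * L j) + y * (ι j * (l * L (pred j)))
      ≈⟨ +-cong (+-congʳ (*-congˡ (+-cong (sym θL) (sym (hL j))))) (*-congˡ (lower j)) ⟩
    (y * (θ (L (suc j)) + L (suc j)) + y * L j) + y * (ι j * L j)
      ≈⟨ solve 4 (λ y a k L → (y :* a :+ y :* L) :+ y :* (k :* L) := y :* a :+ y :* ((con 1 :+ k) :* L)) refl
           y (θ (L (suc j)) + L (suc j)) (ι j) (L j) ⟩
    y * (θ (L (suc j)) + L (suc j)) + y * (ι (suc j) * L j) ∎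
    where
    θL : θ (L (suc j)) ≈ θ l * L j + l * θ (L j)
    θL = trans (θ-cong (hL j)) (θ-* l (L j))
    -- At j = 0 the factor `ι j` vanishes; otherwise l times the preceding power is the current one.
    lower : ∀ j → ι j * (l * L (pred j)) ≈ ι j * L j
    lower zero    = trans (zeroˡ _) (sym (zeroˡ _))
    lower (suc j) = *-congˡ (sym (hL j))

  -- Modelled on l = ln(1 + w), for which (1 + w) θ l = w, and on its powers; again each factor l
  -- contributes one copy of the preceding power.
  log-power : ∀ l (M : ℕ → Carrier) → θ l + w * θ l ≈ w → θ (M 0) ≈ 0# → (∀ j → M (suc j) ≈ l * M j) →
    ∀ j → θ (M j) + w * θ (M j) ≈ w * (ι j * M (pred j))
  log-power l M hl h₀ hM zero    = begin
    θ (M 0) + w * θ (M 0)   ≈⟨ +-cong h₀ (trans (*-congˡ h₀) (zeroʳ w)) ⟩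
    0# + 0#                 ≈⟨ +-identityˡ 0# ⟩
    0#                      ≈⟨ trans (*-congˡ (zeroˡ _)) (zeroʳ w) ⟨
    w * (ι 0 * M 0)         ∎
  log-power l M hl h₀ hM (suc j) = begin
    θ (M (suc j)) + w * θ (M (suc j))
      ≈⟨ +-cong θM (*-congˡ θM) ⟩
    (θ l * M j + l * θ (M j)) + w * (θ l * M j + l * θ (M j))
      ≈⟨ solve 5 (λ w tl l M tM → (tl :* M :+ l :* tM) :+ w :* (tl :* M :+ l :* tM)
           := (tl :+ w :* tl) :* M :+ l :* (tM :+ w :* tM)) refl w (θ l) l (M j) (θ (M j)) ⟩
    (θ l + w * θ l) * M j + l * (θ (M j) + w * θ (M j))
      ≈⟨ +-cong (*-congʳ hl) (*-congˡ (log-power l M hl h₀ hM j)) ⟩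
    w * M j + l * (w * (ι j * M (pred j)))
      ≈⟨ solve 5 (λ w M l k M′ → w :* M :+ l :* (w :* (k :* M′)) := w :* (M :+ k :* (l :* M′))) refl
           w (M j) l (ι j) (M (pred j)) ⟩
    w * (M j + ι j * (l * M (pred j)))
      ≈⟨ *-congˡ (trans (+-congˡ (lower j)) (trans (+-comm _ _) (sym (ι-suc-* j (M j))))) ⟩
    w * (ι (suc j) * M j) ∎
    where
    θM : θ (M (suc j)) ≈ θ l * M j + l * θ (M j)
    θM = trans (θ-cong (hM j)) (θ-* l (M j))
    lower : ∀ j → ι j * (l * M (pred j)) ≈ ι j * M j
    lower zero    = trans (zeroˡ _) (sym (zeroˡ _))
    lower (suc j) = *-congˡ (sym (hM j))

-- The binomial transform and the uniqueness of solutions.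

TorsionFree : ∀ {c ℓ} → CommutativeRing c ℓ → Set (c ⊔ ℓ)
TorsionFree R = ∀ n x y → ι (suc n) * x ≈ ι (suc n) * y → x ≈ y
  where
  open CommutativeRing R
  open BinomialSum commutativeSemiring using (ι)

module Transform {c ℓ} (R : CommutativeRing c ℓ) (ι-cancel : TorsionFree R)
  (a b : CommutativeRing.Carrier R)
  where
  open CommutativeRing R
  open PowerSeriesOver R
  open BinomialSum commutativeSemiring
  open SemiringSolver commutativeSemiring using (solve; _:=_; _:+_; _:*_; con)
  open RawSemiringOps (CommutativeSemiring.rawSemiring commutativeSemiring) using (_^_)
  open SetoidReasoning setoid

  private
    module T = CommutativeSemiring seriesSemiring

    γ β : Carrier
    γ = a + b
    β = - b

    b+β≈0 : b + β ≈ 0#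
    b+β≈0 = -‿inverseʳ b

    y w : Series
    y = mono γ
    w = mono β

    open DifferentialSemiring seriesSemiring ⊕-cancelʳ θ-derivation y w

  +-cancel : ∀ {x y z z′} → z ≈ z′ → x + z ≈ y + z′ → x ≈ y
  +-cancel {x} {y} {z} h e = GroupProperties.∙-cancelʳ +-group z x y (trans e (+-congˡ (sym h)))

  -- The series 1 + w has constant coefficient 1, and coefficient n + 1 of `w ⊛ f` depends only on
  -- coefficient n of `f`, so the coefficients are recovered one after the other.
  1+w-cancel : ∀ f g → f ⊕ w ⊛ f ≋ g ⊕ w ⊛ g → f ≋ g
  1+w-cancel f g h zero    = +-cancel (trans (mono-⊛-zero β f) (sym (mono-⊛-zero β g))) (h 0)
  1+w-cancel f g h (suc n) = +-cancel
    (trans (mono-⊛-suc β f n) (trans (*-congˡ (1+w-cancel f g h n)) (sym (mono-⊛-suc β g n)))) (h (suc n))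

  -- In the homogeneous equation the factor y shifts the index, so coefficient n fixes (n + 1) times
  -- coefficient n + 1; torsion-freeness then divides by n + 1.
  Equation-unique : ∀ F G K → Equation F K → Equation G K → F 0 ≈ G 0 → F ≋ G
  Equation-unique F G K eF eG h₀ zero    = h₀
  Equation-unique F G K eF eG h₀ (suc n) = ι-cancel n _ _ (+-cancel
    (trans (mono-⊛-suc γ (θ G ⊕ G) n) (trans (*-congˡ (+-cong (*-congˡ (sym ih)) (sym ih)))
      (sym (mono-⊛-suc γ (θ F ⊕ F) n))))
    (Equation-difference 1+w-cancel {F} {G} {K} eF eG (suc n)))
    where ih = Equation-unique F G K eF eG h₀ n

  B : Series → Series
  B f n = bin n (λ k l → a ^ k * b ^ l * f k)

  B-cong : ∀ {f g} → f ≋ g → B f ≋ B g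
  B-cong h n = bin-cong n (λ k l → *-congˡ (h k))

  B-⊕ : ∀ f g → B (f ⊕ g) ≋ B f ⊕ B g
  B-⊕ f g n = trans (bin-cong n (λ k l → distribˡ (a ^ k * b ^ l) (f k) (g k)))
    (bin-+ n (λ k l → a ^ k * b ^ l * f k) (λ k l → a ^ k * b ^ l * g k))

  B-scale : ∀ r f n → B (λ k → r * f k) n ≈ r * B f n
  B-scale r f n = trans
    (bin-cong n (λ k l → solve 3 (λ x r f → x :* (r :* f) := r :* (x :* f)) refl (a ^ k * b ^ l) r (f k)))
    (bin-* n r (λ k l → a ^ k * b ^ l * f k))

  B-zero : ∀ f → B f 0 ≈ f 0
  B-zero f = trans (*-congʳ (*-identityˡ 1#)) (*-identityˡ (f 0))

  B-shift : ∀ g n → bin n (λ k l → a ^ suc k * b ^ l * g k) ≈ a * B g n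
  B-shift g n = trans
    (bin-cong n (λ k l → solve 4 (λ a x y z → ((a :* x) :* y) :* z := a :* ((x :* y) :* z)) refl a (a ^ k) (b ^ l) (g k)))
    (bin-* n a (λ k l → a ^ k * b ^ l * g k))

  -- Multiplication by 1 - bz undoes half of Pascal's recursion: the branch that raises the exponent
  -- of b contributes b · `B f n`, which β = -b cancels.
  B-suc : ∀ f n → B f (suc n) + β * B f n ≈ a * B (f ∘ suc) n
  B-suc f n = begin
    B f (suc n) + β * B f n
      ≈⟨ +-congʳ (+-cong (B-shift (f ∘ suc) n) (trans
           (bin-cong n (λ k l → solve 4 (λ b x y z → (x :* (b :* y)) :* z := b :* ((x :* y) :* z)) refl b (a ^ k) (b ^ l) (f k)))
           (bin-* n b (λ k l → a ^ k * b ^ l * f k)))) ⟩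
    (a * B (f ∘ suc) n + b * B f n) + β * B f n
      ≈⟨ solve 4 (λ x b β u → (x :+ b :* u) :+ β :* u := x :+ (b :+ β) :* u) refl _ b β (B f n) ⟩
    a * B (f ∘ suc) n + (b + β) * B f n
      ≈⟨ trans (+-congˡ (trans (*-congʳ b+β≈0) (zeroˡ _))) (+-identityʳ _) ⟩
    a * B (f ∘ suc) n ∎

  -- The composite f(az/(1 - bz)) without its constant term, that is, (1 - bz) B f - f(0).
  shifted : Series → Series
  shifted f zero    = 0#
  shifted f (suc n) = a * B (f ∘ suc) n

  -- The chain rule for u = az/(1 - bz): since θ u = u/(1 - bz), the derivative of f(u) is (θ
  -- f)(u)/(1 - bz). On coefficients this is absorption, k C(n,k) = n C(n-1,k-1).
  B-θ : ∀ f → θ (shifted f) ≋ B (θ f)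
  B-θ f zero    = trans (zeroˡ _) (sym (trans (*-congˡ (zeroˡ _)) (zeroʳ _)))
  B-θ f (suc n) = sym (begin
    B (θ f) (suc n)
      ≈⟨ bin-cong (suc n) absorb ⟩
    bin (suc n) (λ k l → ι k * (a ^ suc (pred k) * b ^ l * f (suc (pred k))))
      ≈⟨ bin-absorbˡ (suc n) (λ k l → a ^ suc k * b ^ l * f (suc k)) ⟩
    ι (suc n) * bin n (λ k l → a ^ suc k * b ^ l * f (suc k))
      ≈⟨ *-congˡ (B-shift (f ∘ suc) n) ⟩
    ι (suc n) * (a * B (f ∘ suc) n) ∎)
    where
    absorb : ∀ k l → a ^ k * b ^ l * (ι k * f k) ≈ ι k * (a ^ suc (pred k) * b ^ l * f (suc (pred k)))
    absorb zero    l = trans (*-congˡ (zeroˡ _)) (trans (zeroʳ _) (sym (zeroˡ _)))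
    absorb (suc k) l = solve 3 (λ x r f → x :* (r :* f) := r :* (x :* f)) refl
      (a ^ suc k * b ^ l) (ι (suc k)) (f (suc k))

  y⊕w : y ⊕ w ≋ mono a
  y⊕w zero          = +-identityˡ 0#
  y⊕w (suc zero)    = trans (+-assoc a b β) (trans (+-congˡ b+β≈0) (+-identityʳ a))
  y⊕w (suc (suc n)) = +-identityˡ 0#

  -- The hypothesis says θ f = z (θ f + f + k). Multiplying the transform of θ f by 1 - bz turns the
  -- factor z into az, and az = y + w because γ + β = a.
  B-equation : ∀ f k → (∀ n → ι (suc n) * f (suc n) ≈ (ι n * f n + f n) + k n) → Equation (B f) (B k)
  B-equation f k hf = transform-equation (θ-mono β) (B f) (B k) (const (f 0)) (shifted f) (θ-const (f 0)) hU hv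
    where
    hU : B f ⊕ w ⊛ B f ≋ const (f 0) ⊕ shifted f
    hU zero    = +-cong (B-zero f) (mono-⊛-zero β (B f))
    hU (suc n) = trans (+-congˡ (mono-⊛-suc β (B f) n)) (trans (B-suc f n) (sym (+-identityˡ _)))
    v = shifted f
    rhs = (θ v ⊕ B f) ⊕ B k
    hv : θ v ⊕ w ⊛ θ v ≋ (y ⊕ w) ⊛ rhs
    hv zero = trans (+-cong (zeroˡ _) (mono-⊛-zero β (θ v))) (trans (+-identityˡ 0#)
      (sym (trans (⊛-cong {g = rhs} y⊕w (λ _ → refl) 0) (mono-⊛-zero a rhs))))
    hv (suc n) = begin
      θ v (suc n) + (w ⊛ θ v) (suc n)
        ≈⟨ +-cong (B-θ f (suc n)) (trans (mono-⊛-suc β (θ v) n) (*-congˡ (B-θ f n))) ⟩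
      B (θ f) (suc n) + β * B (θ f) n
        ≈⟨ B-suc (θ f) n ⟩
      a * B (θ f ∘ suc) n
        ≈⟨ *-congˡ (trans (B-cong hf n) (trans (B-⊕ (θ f ⊕ f) k n) (+-congʳ (B-⊕ (θ f) f n)))) ⟩
      a * ((B (θ f) n + B f n) + B k n)
        ≈⟨ *-congˡ (+-congʳ (+-congʳ (B-θ f n))) ⟨
      a * rhs n
        ≈⟨ trans (⊛-cong {g = rhs} y⊕w (λ _ → refl) (suc n)) (mono-⊛-suc a rhs n) ⟨
      ((y ⊕ w) ⊛ rhs) (suc n) ∎

  module _ (h q : ℕ → ℕ → Carrier)
    (h-suc : ∀ m → h (suc m) 0 ≈ 0#)
    (h-rec : ∀ m n → ι (suc n) * h m (suc n) ≈ (ι n * h m n + h m n) + ι m * h (pred m) n)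
    (q-zero : q 0 0 ≈ 1#) (q-suc : ∀ m → q (suc m) 0 ≈ 0#)
    (q-rec : ∀ m n → ι (suc n) * q m (suc n) + ι n * q m n ≈ ι m * q (pred m) n)
    where

    -- For the intended `h` and `q` these are (-ln(1 - γz))ʲ/(1 - γz) and lnⁱ(1 + βz), with γ = a +
    -- b and β = -b.
    P Q : ℕ → Series
    P j k = h j k * γ ^ k
    Q i l = q i l * β ^ l

    P-equation : ∀ j → θ (P j) ≋ y ⊛ (θ (P j) ⊕ P j) ⊕ y ⊛ (S.ι j ⊛ P (pred j))
    P-equation j zero    = trans (zeroˡ _) (sym (trans
      (+-cong (mono-⊛-zero γ (θ (P j) ⊕ P j)) (mono-⊛-zero γ (S.ι j ⊛ P (pred j)))) (+-identityˡ 0#)))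
    P-equation j (suc n) = begin
      ι (suc n) * (h j (suc n) * (γ * γ ^ n))
        ≈⟨ trans (sym (*-assoc _ _ _)) (*-congʳ (h-rec j n)) ⟩
      ((ι n * h j n + h j n) + ι j * h (pred j) n) * (γ * γ ^ n)
        ≈⟨ solve 6 (λ k u j v c p → ((k :* u :+ u) :+ j :* v) :* (c :* p)
             := c :* (k :* (u :* p) :+ u :* p) :+ c :* (j :* (v :* p))) refl
             (ι n) (h j n) (ι j) (h (pred j) n) γ (γ ^ n) ⟩
      γ * (ι n * P j n + P j n) + γ * (ι j * P (pred j) n)
        ≈⟨ +-cong (mono-⊛-suc γ (θ (P j) ⊕ P j) n)
             (trans (mono-⊛-suc γ (S.ι j ⊛ P (pred j)) n) (*-congˡ (ι-⊛ j (P (pred j)) n))) ⟨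
      (y ⊛ (θ (P j) ⊕ P j) ⊕ y ⊛ (S.ι j ⊛ P (pred j))) (suc n) ∎

    Q-equation : ∀ i → θ (Q i) ⊕ w ⊛ θ (Q i) ≋ w ⊛ (S.ι i ⊛ Q (pred i))
    Q-equation i zero    = trans (+-cong (zeroˡ _) (mono-⊛-zero β (θ (Q i)))) (trans (+-identityˡ 0#)
      (sym (mono-⊛-zero β (S.ι i ⊛ Q (pred i)))))
    Q-equation i (suc n) = begin
      ι (suc n) * (q i (suc n) * (β * β ^ n)) + (w ⊛ θ (Q i)) (suc n)
        ≈⟨ +-congˡ (mono-⊛-suc β (θ (Q i)) n) ⟩
      ι (suc n) * (q i (suc n) * (β * β ^ n)) + β * (ι n * (q i n * β ^ n))
        ≈⟨ solve 6 (λ k′ u′ k u c p → k′ :* (u′ :* (c :* p)) :+ c :* (k :* (u :* p))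
             := (k′ :* u′ :+ k :* u) :* (c :* p)) refl (ι (suc n)) (q i (suc n)) (ι n) (q i n) β (β ^ n) ⟩
      (ι (suc n) * q i (suc n) + ι n * q i n) * (β * β ^ n)
        ≈⟨ *-congʳ (q-rec i n) ⟩
      (ι i * q (pred i) n) * (β * β ^ n)
        ≈⟨ solve 4 (λ i u c p → (i :* u) :* (c :* p) := c :* (i :* (u :* p))) refl (ι i) (q (pred i) n) β (β ^ n) ⟩
      β * (ι i * Q (pred i) n)
        ≈⟨ trans (mono-⊛-suc β (S.ι i ⊛ Q (pred i)) n) (*-congˡ (ι-⊛ i (Q (pred i)) n)) ⟨
      (w ⊛ (S.ι i ⊛ Q (pred i))) (suc n) ∎

    W : ℕ → Series
    W m = S.bin m (λ j i → P j ⊛ Q i)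

    bin-0 : ∀ m {F} → (∀ j i → F j i ≈ 0#) → bin m F ≈ 0#
    bin-0 zero    e = e 0 0
    bin-0 (suc m) e = trans (+-cong (bin-0 m (λ j i → e (suc j) i)) (bin-0 m (λ j i → e j (suc i)))) (+-identityˡ 0#)

    -- For m ≥ 1 every term of the binomial sum has j ≥ 1 or i ≥ 1, so one of its factors has
    -- constant coefficient 0.
    initial : ∀ m → B (h m) 0 ≈ W m 0
    initial zero    = trans (B-zero (h 0)) (sym (begin
      h 0 0 * 1# * (q 0 0 * 1#) + 0#
        ≈⟨ solve 2 (λ x y → (x :* con 1) :* (y :* con 1) :+ con 0 := x :* y) refl (h 0 0) (q 0 0) ⟩
      h 0 0 * q 0 0   ≈⟨ *-congˡ q-zero ⟩
      h 0 0 * 1#      ≈⟨ *-identityʳ _ ⟩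
      h 0 0           ∎))
    initial (suc m) = trans (trans (B-zero (h (suc m))) (h-suc m)) (sym (trans
      (bin-coefficient (suc m) (λ j i → P j ⊛ Q i) 0)
      (trans (+-cong
        (bin-0 m (λ j i → trans (+-identityʳ _) (trans (*-congʳ (trans (*-congʳ (h-suc j)) (zeroˡ _))) (zeroˡ _))))
        (bin-0 m (λ j i → trans (+-identityʳ _) (trans (*-congˡ (trans (*-congʳ (q-suc i)) (zeroˡ _))) (zeroʳ _)))))
        (+-identityˡ 0#))))

    -- Induction on m: the result for m - 1 identifies the two inhomogeneous terms, which both
    -- vanish for m = 0, and uniqueness does the rest.
    B≋W : ∀ m → B (h m) ≋ W m
    B≋W m = Equation-unique (B (h m)) (W m) (S.ι m ⊛ W (pred m))
      (T.trans (B-equation (h m) (λ n → ι m * h (pred m) n) (h-rec m)) (T.+-congˡ {z} (T.*-congˡ {y ⊕ w} K≋)))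
      (bin-product-equation P Q P-equation Q-equation m) (initial m)
      where
      z = y ⊛ (θ (B (h m)) ⊕ B (h m)) ⊕ w ⊛ (y ⊛ (θ (B (h m)) ⊕ B (h m)))
      lower : ∀ m n → ι m * B (h (pred m)) n ≈ ι m * W (pred m) n
      lower zero    n = trans (zeroˡ _) (sym (zeroˡ _))
      lower (suc m) n = *-congˡ (B≋W m n)
      K≋ : B (λ n → ι m * h (pred m) n) ≋ S.ι m ⊛ W (pred m)
      K≋ n = trans (B-scale (ι m) (h (pred m)) n) (trans (lower m n) (sym (ι-⊛ m (W (pred m)) n)))

    binomial-transform : ∀ m n →
      ∑ n (λ k → ι (n C k) * (a ^ k * b ^ (n ∸ k) * h m k))
      ≈ ∑ m (λ j → ι (m C j) * ∑ n (λ k → (h j k * (a + b) ^ k) * (q (m ∸ j) (n ∸ k) * (- b) ^ (n ∸ k))))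
    binomial-transform m n = begin
      ∑ n (λ k → ι (n C k) * (a ^ k * b ^ (n ∸ k) * h m k))  ≈⟨ ∑-C n (λ k l → a ^ k * b ^ l * h m k) ⟩
      B (h m) n                                              ≈⟨ B≋W m n ⟩
      W m n                                                  ≈⟨ bin-coefficient m (λ j i → P j ⊛ Q i) n ⟩
      bin m (λ j i → (P j ⊛ Q i) n)                          ≈⟨ ∑-C m (λ j i → (P j ⊛ Q i) n) ⟨
      ∑ m (λ j → ι (m C j) * (P j ⊛ Q (m ∸ j)) n)            ∎

open import Defs

-- Rational coefficients

module ℚ⟦z⟧ = PowerSeriesOver ℚₚ.+-*-commutativeRing
open ℚ⟦z⟧ using (_⊛_; mono; θ; mono-⊛-suc; ι-⊛) renaming (module S to ℚSeries)
-- Here y = w = z, which suits -ln(1 - z) and ln(1 + z).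
open DifferentialSemiring ℚ⟦z⟧.seriesSemiring ℚ⟦z⟧.⊕-cancelʳ ℚ⟦z⟧.θ-derivation (mono 1ℚ) (mono 1ℚ)
  using (log-power-over-1-y; log-power)
open BinomialSum (CommutativeRing.commutativeSemiring ℚₚ.+-*-commutativeRing) using () renaming (ι to ιᵠ)

-- The operation `_/_` reduces its fraction, so arithmetic is moved to unnormalised fractions, where
-- equality is cross-multiplication.
fromℚᵘ-+ : ∀ p q → ℚ.fromℚᵘ p ℚ.+ ℚ.fromℚᵘ q ≡ ℚ.fromℚᵘ (p ℚᵘ.+ q)
fromℚᵘ-+ p q = ℚₚ.toℚᵘ-injective (ℚᵘₚ.≃-trans (ℚₚ.toℚᵘ-homo-+ (ℚ.fromℚᵘ p) (ℚ.fromℚᵘ q))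
  (ℚᵘₚ.≃-trans (ℚᵘₚ.+-cong (ℚₚ.toℚᵘ-fromℚᵘ p) (ℚₚ.toℚᵘ-fromℚᵘ q)) (ℚᵘₚ.≃-sym (ℚₚ.toℚᵘ-fromℚᵘ (p ℚᵘ.+ q)))))

fromℚᵘ-* : ∀ p q → ℚ.fromℚᵘ p ℚ.* ℚ.fromℚᵘ q ≡ ℚ.fromℚᵘ (p ℚᵘ.* q)
fromℚᵘ-* p q = ℚₚ.toℚᵘ-injective (ℚᵘₚ.≃-trans (ℚₚ.toℚᵘ-homo-* (ℚ.fromℚᵘ p) (ℚ.fromℚᵘ q))
  (ℚᵘₚ.≃-trans (ℚᵘₚ.*-cong (ℚₚ.toℚᵘ-fromℚᵘ p) (ℚₚ.toℚᵘ-fromℚᵘ q)) (ℚᵘₚ.≃-sym (ℚₚ.toℚᵘ-fromℚᵘ (p ℚᵘ.* q)))))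

/1-+ : ∀ i j → i / 1 ℚ.+ j / 1 ≡ (i ℤ.+ j) / 1
/1-+ i j = ≡.trans (fromℚᵘ-+ (mkℚᵘ i 0) (mkℚᵘ j 0)) (ℚₚ.fromℚᵘ-cong {mkℚᵘ i 0 ℚᵘ.+ mkℚᵘ j 0} {mkℚᵘ (i ℤ.+ j) 0}
  (*≡* (ℤSolver.solve 2 (λ i j → (i :* con 1ℤ :+ j :* con 1ℤ) :* con 1ℤ := (i :+ j) :* con 1ℤ) ≡.refl i j)))
  where open ℤSolver

/1≡ι : ∀ n → ℤ.+ n / 1 ≡ ιᵠ n
/1≡ι zero    = ≡.refl
/1≡ι (suc n) = ≡.trans (≡.sym (/1-+ 1ℤ (ℤ.+ n))) (≡.cong (1ℚ ℚ.+_) (/1≡ι n))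

ι-*-/ : ∀ n i → ιᵠ (suc n) ℚ.* (i / suc n) ≡ i / 1
ι-*-/ n i = ≡.trans (≡.cong (ℚ._* (i / suc n)) (≡.sym (/1≡ι (suc n))))
  (≡.trans (fromℚᵘ-* (mkℚᵘ (ℤ.+ suc n) 0) (mkℚᵘ i n))
    (ℚₚ.fromℚᵘ-cong {mkℚᵘ (ℤ.+ suc n) 0 ℚᵘ.* mkℚᵘ i n} {mkℚᵘ i 0} (*≡* (≡.trans
      (ℤSolver.solve 2 (λ d i → (d :* i) :* con 1ℤ := i :* d) ≡.refl (ℤ.+ suc n) i)
      (≡.cong (λ k → i ℤ.* ℤ.+ k) (≡.sym (ℕₚ.*-identityˡ (suc n))))))))
  where open ℤSolver

1/-* : ∀ m n .{{_ : ℕ.NonZero m}} .{{_ : ℕ.NonZero n}} .{{_ : ℕ.NonZero (m ℕ.* n)}} →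
  1ℤ / (m ℕ.* n) ≡ (1ℤ / m) ℚ.* (1ℤ / n)
1/-* m@(suc m-1) n@(suc n-1) = ≡.sym (fromℚᵘ-* (mkℚᵘ 1ℤ m-1) (mkℚᵘ 1ℤ n-1))

/-*-/ : ∀ m n .{{_ : ℕ.NonZero m}} .{{_ : ℕ.NonZero n}} → (ℤ.+ m / n) ℚ.* (ℤ.+ n / m) ≡ 1ℚ
/-*-/ m@(suc m-1) n@(suc n-1) = ≡.trans (fromℚᵘ-* (mkℚᵘ (ℤ.+ m) n-1) (mkℚᵘ (ℤ.+ n) m-1))
  (ℚₚ.fromℚᵘ-cong {mkℚᵘ (ℤ.+ m) n-1 ℚᵘ.* mkℚᵘ (ℤ.+ n) m-1} {ℚᵘ.1ℚᵘ} (*≡* (≡.trans (ℤₚ.*-identityʳ _)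
    (≡.trans (ℤₚ.*-comm (ℤ.+ m) (ℤ.+ n)) (≡.sym (ℤₚ.*-identityˡ _))))))

-- Series for the multiple harmonic-like numbers, and the two recurrences.

-ln[1-z] : PowerSeries
-ln[1-z] zero    = 0ℚ
-ln[1-z] (suc n) = 1ℤ / suc n

-ln[1-z]^_/[1-z] : ℕ → PowerSeries
-ln[1-z]^ zero /[1-z]  = λ _ → 1ℚ
-ln[1-z]^ suc m /[1-z] = -ln[1-z] *ˢ -ln[1-z]^ m /[1-z]

sumᴸ : List ℚ → ℚ
sumᴸ = List.foldr ℚ._+_ 0ℚ

sumᴸ-++ : ∀ xs ys → sumᴸ (xs List.++ ys) ≡ sumᴸ xs ℚ.+ sumᴸ ys
sumᴸ-++ []       ys = ≡.sym (ℚₚ.+-identityˡ _)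
sumᴸ-++ (x ∷ xs) ys = ≡.trans (≡.cong (x ℚ.+_) (sumᴸ-++ xs ys)) (≡.sym (ℚₚ.+-assoc x _ _))

sumᴸ-filter : ∀ {A : Set} {P : A → Set} (P? : ∀ x → Dec (P x)) (f : A → ℚ) xs →
  sumᴸ (List.map f (List.filter P? xs)) ≡ sumᴸ (List.map (λ x → if does (P? x) then f x else 0ℚ) xs)
sumᴸ-filter P? f []       = ≡.refl
sumᴸ-filter P? f (x ∷ xs) with does (P? x)
... | true  = ≡.cong (f x ℚ.+_) (sumᴸ-filter P? f xs)
... | false = ≡.trans (sumᴸ-filter P? f xs) (≡.sym (ℚₚ.+-identityˡ _))

sumᴸ-product : ∀ {A B C : Set} (f : C → ℚ) (g : A → B → C) xs ys →
  sumᴸ (List.map f (List.cartesianProductWith g xs ys))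
    ≡ sumᴸ (List.map (λ x → sumᴸ (List.map (λ y → f (g x y)) ys)) xs)
sumᴸ-product f g []       ys = ≡.refl
sumᴸ-product f g (x ∷ xs) ys = ≡.trans (≡.cong sumᴸ (Listₚ.map-++ f (List.map (g x) ys) _))
  (≡.trans (sumᴸ-++ (List.map f (List.map (g x) ys)) _)
    (≡.cong₂ ℚ._+_ (≡.cong sumᴸ (≡.sym (Listₚ.map-∘ ys))) (sumᴸ-product f g xs ys)))

sumᴸ-* : ∀ {A : Set} r (f : A → ℚ) xs → sumᴸ (List.map (λ x → r ℚ.* f x) xs) ≡ r ℚ.* sumᴸ (List.map f xs)
sumᴸ-* r f []       = ≡.sym (ℚₚ.*-zeroʳ r)
sumᴸ-* r f (x ∷ xs) = ≡.trans (≡.cong (r ℚ.* f x ℚ.+_) (sumᴸ-* r f xs)) (≡.sym (ℚₚ.*-distribˡ-+ r _ _))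

sumᴸ-0 : ∀ {A : Set} (xs : List A) → sumᴸ (List.map (λ _ → 0ℚ) xs) ≡ 0ℚ
sumᴸ-0 []       = ≡.refl
sumᴸ-0 (x ∷ xs) = ≡.trans (ℚₚ.+-identityˡ _) (sumᴸ-0 xs)

sumᴸ-cong : ∀ {A : Set} {f g : A → ℚ} → (∀ x → f x ≡ g x) → ∀ xs → sumᴸ (List.map f xs) ≡ sumᴸ (List.map g xs)
sumᴸ-cong h xs = ≡.cong sumᴸ (Listₚ.map-cong h xs)

-- The entry i stands for the part i + 1, so the left side is what (i + 1) + t ≤ n computes to. On
-- the right, i < n guards against truncation in the subtraction.
+-<ᵇ : ∀ i t n → (i ℕ.+ t ℕ.<ᵇ n) ≡ (i ℕ.<ᵇ n) ∧ (t ℕ.≤ᵇ n ∸ suc i)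
+-<ᵇ zero    t       zero    = ≡.refl
+-<ᵇ zero    zero    (suc n) = ≡.refl
+-<ᵇ zero    (suc t) (suc n) = ≡.refl
+-<ᵇ (suc i) t       zero    = ≡.refl
+-<ᵇ (suc i) t       (suc n) = +-<ᵇ i t n

-- Separating the bound N on the entries from the bound n on their sum makes induction on m possible.
boundedH : ℕ → ℕ → ℕ → ℚ
boundedH N n m = sumᴸ (List.map (λ u → if total u ℕ.≤ᵇ n then reciprocal u else 0ℚ) (tuples N m))

boundedH-suc : ∀ N n m → boundedH N n (suc m) ≡ sumᴸ (List.map
  (λ i → if toℕ i ℕ.<ᵇ n then (1ℤ / suc (toℕ i)) ℚ.* boundedH N (n ∸ suc (toℕ i)) m else 0ℚ) (List.allFin N))
boundedH-suc N n m = ≡.trans (sumᴸ-product _ _∷_ (List.allFin N) (tuples N m)) (sumᴸ-cong inner (List.allFin N))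
  where
  inner : ∀ i → sumᴸ (List.map (λ u → if total (i ∷ u) ℕ.≤ᵇ n then reciprocal (i ∷ u) else 0ℚ) (tuples N m))
    ≡ (if toℕ i ℕ.<ᵇ n then (1ℤ / suc (toℕ i)) ℚ.* boundedH N (n ∸ suc (toℕ i)) m else 0ℚ)
  inner i = ≡.trans (sumᴸ-cong (λ u → ≡.cong (λ t → if t then reciprocal (i ∷ u) else 0ℚ)
    (+-<ᵇ (toℕ i) (total u) n)) (tuples N m)) split
    where
    split : sumᴸ (List.map (λ u → if (toℕ i ℕ.<ᵇ n) ∧ (total u ℕ.≤ᵇ n ∸ suc (toℕ i))
                                    then reciprocal (i ∷ u) else 0ℚ) (tuples N m))
      ≡ (if toℕ i ℕ.<ᵇ n then (1ℤ / suc (toℕ i)) ℚ.* boundedH N (n ∸ suc (toℕ i)) m else 0ℚ)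
    split with toℕ i ℕ.<ᵇ n
    ... | false = sumᴸ-0 (tuples N m)
    ... | true  = ≡.trans (sumᴸ-cong factor (tuples N m)) (sumᴸ-* (1ℤ / suc (toℕ i)) _ (tuples N m))
      where
      factor : ∀ u → (if total u ℕ.≤ᵇ n ∸ suc (toℕ i) then reciprocal (i ∷ u) else 0ℚ)
        ≡ (1ℤ / suc (toℕ i)) ℚ.* (if total u ℕ.≤ᵇ n ∸ suc (toℕ i) then reciprocal u else 0ℚ)
      factor u with total u ℕ.≤ᵇ n ∸ suc (toℕ i)
      ... | true  = 1/-* (suc (toℕ i)) (denominator u) {{_}} {{denominator≢0 u}} {{denominator≢0 (i ∷ u)}}
      ... | false = ≡.sym (ℚₚ.*-zeroʳ (1ℤ / suc (toℕ i)))

-- The summand takes k and n - k as separate arguments, so that the induction can raise the first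
-- while n decreases.
truncate : ∀ N n (g : ℕ → ℕ → ℚ) → suc n ℕ.≤ N →
  sumᴸ (List.tabulate {n = N} (λ i → if toℕ i ℕ.<ᵇ suc n then g (toℕ i) (n ∸ toℕ i) else 0ℚ))
    ≡ ∑≤ᵠ n (λ k → g k (n ∸ k))
truncate (suc N) zero    g _         = ≡.cong (g 0 0 ℚ.+_) (zeros N)
  where
  zeros : ∀ N → sumᴸ (List.tabulate {n = N} (λ _ → 0ℚ)) ≡ 0ℚ
  zeros zero    = ≡.refl
  zeros (suc N) = ≡.trans (ℚₚ.+-identityˡ _) (zeros N)
truncate (suc N) (suc n) g (s≤s n<N) = ≡.cong (g 0 (suc n) ℚ.+_) (truncate N n (λ k → g (suc k)) n<N)

boundedH≡ : ∀ N n m → n ℕ.≤ N → boundedH N n m ≡ -ln[1-z]^ m /[1-z] n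
boundedH≡ N n       zero    _   = ≡.refl
boundedH≡ N zero    (suc m) _   = ≡.trans (boundedH-suc N 0 m) (≡.trans (sumᴸ-0 (List.allFin N))
  (≡.sym (≡.trans (ℚₚ.+-identityʳ _) (ℚₚ.*-zeroˡ (-ln[1-z]^ m /[1-z] 0)))))
boundedH≡ N (suc n) (suc m) n<N = begin
  boundedH N (suc n) (suc m)
    ≡⟨ boundedH-suc N (suc n) m ⟩
  sumᴸ (List.map (λ i → if toℕ i ℕ.<ᵇ suc n then (1ℤ / suc (toℕ i)) ℚ.* boundedH N (n ∸ toℕ i) m else 0ℚ) (List.allFin N))
    ≡⟨ sumᴸ-cong (λ i → ≡.cong (λ t → if toℕ i ℕ.<ᵇ suc n then (1ℤ / suc (toℕ i)) ℚ.* t else 0ℚ)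
         (boundedH≡ N (n ∸ toℕ i) m (ℕₚ.≤-trans (ℕₚ.m∸n≤m n (toℕ i)) (ℕₚ.<⇒≤ n<N)))) (List.allFin N) ⟩
  sumᴸ (List.map (λ i → if toℕ i ℕ.<ᵇ suc n then (1ℤ / suc (toℕ i)) ℚ.* -ln[1-z]^ m /[1-z] (n ∸ toℕ i) else 0ℚ) (List.allFin N))
    ≡⟨ ≡.cong sumᴸ (Listₚ.map-tabulate {n = N} (λ i → i) _) ⟩
  _ ≡⟨ truncate N n (λ k l → (1ℤ / suc k) ℚ.* -ln[1-z]^ m /[1-z] l) n<N ⟩
  ∑≤ᵠ n (λ k → (1ℤ / suc k) ℚ.* -ln[1-z]^ m /[1-z] (n ∸ k))
    -- The convolution starts at index 0, where -ln(1 - z) has coefficient 0; the parts of a tuple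
    -- start at 1.
    ≡⟨ ≡.trans (≡.cong (ℚ._+ rest) (ℚₚ.*-zeroˡ (-ln[1-z]^ m /[1-z] (suc n)))) (ℚₚ.+-identityˡ rest) ⟨
  -ln[1-z]^ suc m /[1-z] (suc n) ∎
  where
  open ≡.≡-Reasoning
  rest = ∑≤ᵠ n (λ k → (1ℤ / suc k) ℚ.* -ln[1-z]^ m /[1-z] (n ∸ k))

H≡ : ∀ n m → H n m ≡ -ln[1-z]^ m /[1-z] n
H≡ n zero    = ≡.refl
H≡ n (suc m) = ≡.trans (sumᴸ-filter (λ v → (1 ℕₚ.≤? total v) ×-dec (total v ℕₚ.≤? n)) reciprocal (tuples n (suc m)))
  -- In a nonempty tuple the first part is a successor, so the test `1 ≤? total v` computes to true
  -- and only the upper bound is left.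
  (≡.trans (sumᴸ-cong (λ { (i ∷ u) → ≡.refl }) (tuples n (suc m))) (boundedH≡ n n (suc m) ℕₚ.≤-refl))

z-suc : ∀ f n → (mono 1ℚ ⊛ f) (suc n) ≡ f n
z-suc f n = ≡.trans (mono-⊛-suc 1ℚ f n) (ℚₚ.*-identityˡ (f n))

-- The coefficient of zⁿ⁺¹ in the differential equation of (-ln(1 - z))ᵐ/(1 - z).
H-recurrence : ∀ m n → ιᵠ (suc n) ℚ.* H (suc n) m
  ≡ (ιᵠ n ℚ.* H n m ℚ.+ H n m) ℚ.+ ιᵠ m ℚ.* H n (pred m)
H-recurrence m n
  rewrite H≡ (suc n) m | H≡ n m | H≡ n (pred m) = begin
  θ (L m) (suc n)
    -- The products `_*ˢ_` and `_⊛_` agree by computation, so reflexivity proves the recursion of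
    -- `L`.
    ≡⟨ log-power-over-1-y -ln[1-z] L θ-log θ-L₀ (λ _ _ → ≡.refl) m (suc n) ⟩
  (mono 1ℚ ⊛ (λ k → θ (L m) k ℚ.+ L m k)) (suc n) ℚ.+ (mono 1ℚ ⊛ (ℚSeries.ι m ⊛ L (pred m))) (suc n)
    ≡⟨ ≡.cong₂ ℚ._+_ (z-suc (λ k → θ (L m) k ℚ.+ L m k) n)
         (≡.trans (z-suc (ℚSeries.ι m ⊛ L (pred m)) n) (ι-⊛ m (L (pred m)) n)) ⟩
  (θ (L m) n ℚ.+ L m n) ℚ.+ ιᵠ m ℚ.* L (pred m) n ∎
  where
  open ≡.≡-Reasoning
  L : ℕ → PowerSeries
  L = -ln[1-z]^_/[1-z]
  θ-log : ∀ n → θ -ln[1-z] n ≡ (mono 1ℚ ⊛ θ -ln[1-z]) n ℚ.+ mono 1ℚ n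
  θ-log zero          = ≡.refl
  θ-log (suc zero)    = ≡.refl
  θ-log (suc (suc n)) = ≡.trans (ι-*-/ (suc n) 1ℤ) (≡.sym
    (≡.trans (ℚₚ.+-identityʳ _) (≡.trans (z-suc (θ -ln[1-z]) (suc n)) (ι-*-/ n 1ℤ))))
  θ-L₀ : ∀ n → θ (L 0) n ≡ (mono 1ℚ ⊛ (λ k → θ (L 0) k ℚ.+ L 0 k)) n
  θ-L₀ zero    = ≡.refl
  θ-L₀ (suc n) = ≡.trans (ℚₚ.*-identityʳ _) (≡.trans (ℚₚ.+-comm 1ℚ (ιᵠ n)) (≡.sym
    (≡.trans (z-suc (λ k → θ (L 0) k ℚ.+ L 0 k) n) (≡.cong (ℚ._+ 1ℚ) (ℚₚ.*-identityʳ (ιᵠ n))))))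

-- The coefficient of zⁿ⁺¹ in (1 + z) θ(lnᵐ(1 + z)) = m z lnᵐ⁻¹(1 + z).
ln^-recurrence : ∀ m n → ιᵠ (suc n) ℚ.* (ln[1+z] ^ˢ m) (suc n) ℚ.+ ιᵠ n ℚ.* (ln[1+z] ^ˢ m) n
  ≡ ιᵠ m ℚ.* (ln[1+z] ^ˢ pred m) n
ln^-recurrence m n = begin
  θ (M m) (suc n) ℚ.+ θ (M m) n
    ≡⟨ ≡.cong (θ (M m) (suc n) ℚ.+_) (z-suc (θ (M m)) n) ⟨
  θ (M m) (suc n) ℚ.+ (mono 1ℚ ⊛ θ (M m)) (suc n)
    ≡⟨ log-power ln[1+z] M θ-log θ-M₀ (λ _ _ → ≡.refl) m (suc n) ⟩
  (mono 1ℚ ⊛ (ℚSeries.ι m ⊛ M (pred m))) (suc n)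
    ≡⟨ ≡.trans (z-suc (ℚSeries.ι m ⊛ M (pred m)) n) (ι-⊛ m (M (pred m)) n) ⟩
  ιᵠ m ℚ.* M (pred m) n ∎
  where
  open ≡.≡-Reasoning
  M : ℕ → PowerSeries
  M = ln[1+z] ^ˢ_
  θ-M₀ : ∀ n → θ (M 0) n ≡ 0ℚ
  θ-M₀ zero    = ≡.refl
  θ-M₀ (suc n) = ℚₚ.*-zeroʳ (ιᵠ (suc n))
  θ-log : ∀ n → θ ln[1+z] n ℚ.+ (mono 1ℚ ⊛ θ ln[1+z]) n ≡ mono 1ℚ n
  θ-log zero          = ≡.refl
  θ-log (suc zero)    = ≡.refl
  θ-log (suc (suc n)) = ≡.trans (≡.cong₂ ℚ._+_ (ι-*-/ (suc n) (-1ℤ ℤ.^ suc n))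
      (≡.trans (z-suc (θ ln[1+z]) (suc n)) (ι-*-/ n (-1ℤ ℤ.^ n))))
    (≡.trans (/1-+ (-1ℤ ℤ.^ suc n) (-1ℤ ℤ.^ n)) (≡.cong (_/ 1)
      (ℤSolver.solve 1 (λ i → con -1ℤ :* i :+ i := con ℤ.0ℤ) ≡.refl (-1ℤ ℤ.^ n))))
    where open ℤSolver

-- Complex coefficients

private
  module ℂᵣ = CommutativeRing ℂ-commutativeRing
  open BinomialSum ℂᵣ.commutativeSemiring using (ι; ∑-cong)
  open SemiringSolver ℂᵣ.commutativeSemiring using (solve; _:=_; _:*_)
  open SetoidReasoning ℂᵣ.setoid

ℚ→ℂ-+ : ∀ p q → ℚ→ℂ (p ℚ.+ q) ≈ ℚ→ℂ p + ℚ→ℂ q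
ℚ→ℂ-+ p q = mk≈ (pointwise λ _ → ≡.refl) (pointwise λ _ → ≡.refl)

ℚ→ℂ-* : ∀ p q → ℚ→ℂ (p ℚ.* q) ≈ ℚ→ℂ p * ℚ→ℂ q
ℚ→ℂ-* p q = mk≈ (pointwise λ _ → ≡.sym (ℚₚ.+-identityʳ (p ℚ.* q)))
  (pointwise λ _ → ≡.sym (≡.cong₂ ℚ._+_ (ℚₚ.*-zeroʳ p) (ℚₚ.*-zeroˡ q)))

ℚ→ℂ-ι : ∀ n → ℚ→ℂ (ιᵠ n) ≈ ι n
ℚ→ℂ-ι zero    = ℂᵣ.refl
ℚ→ℂ-ι (suc n) = ℂᵣ.trans (ℚ→ℂ-+ 1ℚ (ιᵠ n)) (ℂᵣ.+-congˡ (ℚ→ℂ-ι n))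

ℚ→ℂ-ι-* : ∀ n p → ℚ→ℂ (ιᵠ n ℚ.* p) ≈ ι n * ℚ→ℂ p
ℚ→ℂ-ι-* n p = ℂᵣ.trans (ℚ→ℂ-* (ιᵠ n) p) (ℂᵣ.*-congʳ (ℚ→ℂ-ι n))

ℕ→ℂ-ι : ∀ n → ℕ→ℂ n ≈ ι n
ℕ→ℂ-ι n = ℂᵣ.trans (ℂᵣ.reflexive (≡.cong ℚ→ℂ (/1≡ι n))) (ℚ→ℂ-ι n)

ι-cancel : TorsionFree ℂ-commutativeRing
ι-cancel n x y h = begin
  x                    ≈⟨ undo x ⟨
  r * (ι (suc n) * x)  ≈⟨ ℂᵣ.*-congˡ h ⟩
  r * (ι (suc n) * y)  ≈⟨ undo y ⟩
  y                    ∎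
  where
  r = ℚ→ℂ (1ℤ / suc n)
  undo : ∀ x → r * (ι (suc n) * x) ≈ x
  undo x = begin
    r * (ι (suc n) * x)  ≈⟨ solve 3 (λ r k x → r :* (k :* x) := (k :* r) :* x) ℂᵣ.refl r (ι (suc n)) x ⟩
    ι (suc n) * r * x    ≈⟨ ℂᵣ.*-congʳ (ℚ→ℂ-ι-* (suc n) (1ℤ / suc n)) ⟨
    ℚ→ℂ (ιᵠ (suc n) ℚ.* (1ℤ / suc n)) * x  ≈⟨ ℂᵣ.*-congʳ (ℂᵣ.reflexive (≡.cong ℚ→ℂ (ι-*-/ n 1ℤ))) ⟩
    1ℂ * x               ≈⟨ ℂᵣ.*-identityˡ x ⟩
    x                    ∎

[-1]^*^ : ∀ b n → (- 1ℂ) ^ n * b ^ n ≈ (- b) ^ n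
[-1]^*^ b zero    = ℂᵣ.*-identityˡ 1ℂ
[-1]^*^ b (suc n) = begin
  (- 1ℂ * (- 1ℂ) ^ n) * (b * b ^ n)
    ≈⟨ solve 4 (λ e x b y → (e :* x) :* (b :* y) := (e :* b) :* (x :* y)) ℂᵣ.refl (- 1ℂ) ((- 1ℂ) ^ n) b (b ^ n) ⟩
  (- 1ℂ * b) * ((- 1ℂ) ^ n * b ^ n)
    ≈⟨ ℂᵣ.*-cong (RingProperties.-1*x≈-x ℂᵣ.ring b) ([-1]^*^ b n) ⟩
  - b * (- b) ^ n ∎

-- The factor l!/i! inside the Stirling number is the reciprocal of i!/l!, so the bare coefficient
-- of the power of the logarithm remains.
!/!-s : ∀ i l → ℚ→ℂ (i !/ l !) * ℚ→ℂ (s l i) ≈ ℚ→ℂ ((ln[1+z] ^ˢ i) l)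
!/!-s i l = ℂᵣ.trans (ℂᵣ.sym (ℚ→ℂ-* (i !/ l !) (s l i))) (ℂᵣ.reflexive (≡.cong ℚ→ℂ (≡.trans
  (≡.sym (ℚₚ.*-assoc (i !/ l !) (l !/ i !) ((ln[1+z] ^ˢ i) l)))
  (≡.trans (≡.cong (ℚ._* (ln[1+z] ^ˢ i) l) (/-*-/ (i ℕ.!) (l ℕ.!) {{i ℕₚ.!≢0}} {{l ℕₚ.!≢0}}))
    (ℚₚ.*-identityˡ ((ln[1+z] ^ˢ i) l))))))

theorem1 : (a b : ℂ) (m n : ℕ) →
    S n a b m
    ≈ ∑[ j ≤ m ] (ℕ→ℂ (m C j) *
    (∑[ k ≤ n ] (ℚ→ℂ (H k j) * (a + b) ^ k * ℚ→ℂ ((m ∸ j) !/ (n ∸ k) !)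
    * (- 1ℂ) ^ (n ∸ k) * b ^ (n ∸ k) * ℚ→ℂ (s (n ∸ k) (m ∸ j)))))
theorem1 a b m n = begin
  S n a b m
    ≈⟨ ∑-cong n (λ k _ → ℂᵣ.trans
         (solve 4 (λ x y z t → ((x :* y) :* z) :* t := x :* ((y :* z) :* t)) ℂᵣ.refl
           (ℕ→ℂ (n C k)) (a ^ k) (b ^ (n ∸ k)) (h m k))
         (ℂᵣ.*-congʳ (ℕ→ℂ-ι (n C k)))) ⟩
  ∑[ k ≤ n ] (ι (n C k) * (a ^ k * b ^ (n ∸ k) * h m k))
    ≈⟨ Transform.binomial-transform ℂ-commutativeRing ι-cancel a b
         h q h-suc h-rec q-zero q-suc q-rec m n ⟩
  ∑[ j ≤ m ] (ι (m C j) * (∑[ k ≤ n ] (h j k * (a + b) ^ k * (q (m ∸ j) (n ∸ k) * (- b) ^ (n ∸ k)))))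
    ≈⟨ ∑-cong m (λ j _ → ℂᵣ.*-cong (ℕ→ℂ-ι (m C j)) (∑-cong n (λ k _ → term (h j k) ((a + b) ^ k) (m ∸ j) (n ∸ k)))) ⟨
  _ ∎
  where
  h q : ℕ → ℕ → ℂ
  h m k = ℚ→ℂ (H k m)
  q i l = ℚ→ℂ ((ln[1+z] ^ˢ i) l)
  h-suc : ∀ m → h (suc m) 0 ≈ 0ℂ
  -- No nonempty tuple has entries in `Fin 0`, so `H 0 (suc m)` computes to an empty sum.
  h-suc m = ℂᵣ.refl
  h-rec : ∀ m n → ι (suc n) * h m (suc n) ≈ (ι n * h m n + h m n) + ι m * h (pred m) n
  h-rec m n = begin
    ι (suc n) * h m (suc n)
      ≈⟨ ℚ→ℂ-ι-* (suc n) (H (suc n) m) ⟨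
    ℚ→ℂ (ιᵠ (suc n) ℚ.* H (suc n) m)
      ≈⟨ ℂᵣ.reflexive (≡.cong ℚ→ℂ (H-recurrence m n)) ⟩
    ℚ→ℂ ((ιᵠ n ℚ.* H n m ℚ.+ H n m) ℚ.+ ιᵠ m ℚ.* H n (pred m))
      ≈⟨ ℂᵣ.trans (ℚ→ℂ-+ (ιᵠ n ℚ.* H n m ℚ.+ H n m) (ιᵠ m ℚ.* H n (pred m)))
           (ℂᵣ.+-congʳ (ℚ→ℂ-+ (ιᵠ n ℚ.* H n m) (H n m))) ⟩
    (ℚ→ℂ (ιᵠ n ℚ.* H n m) + h m n) + ℚ→ℂ (ιᵠ m ℚ.* H n (pred m))
      ≈⟨ ℂᵣ.+-cong (ℂᵣ.+-congʳ (ℚ→ℂ-ι-* n (H n m))) (ℚ→ℂ-ι-* m (H n (pred m))) ⟩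
    (ι n * h m n + h m n) + ι m * h (pred m) n ∎
  q-zero : q 0 0 ≈ 1ℂ
  q-zero = ℂᵣ.refl
  q-suc : ∀ m → q (suc m) 0 ≈ 0ℂ
  q-suc m = ℂᵣ.reflexive (≡.cong ℚ→ℂ (≡.trans (ℚₚ.+-identityʳ _) (ℚₚ.*-zeroˡ ((ln[1+z] ^ˢ m) 0))))
  q-rec : ∀ m n → ι (suc n) * q m (suc n) + ι n * q m n ≈ ι m * q (pred m) n
  q-rec m n = begin
    ι (suc n) * q m (suc n) + ι n * q m n
      ≈⟨ ℂᵣ.+-cong (ℚ→ℂ-ι-* (suc n) (M m (suc n))) (ℚ→ℂ-ι-* n (M m n)) ⟨
    ℚ→ℂ (ιᵠ (suc n) ℚ.* M m (suc n)) + ℚ→ℂ (ιᵠ n ℚ.* M m n)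
      ≈⟨ ℚ→ℂ-+ (ιᵠ (suc n) ℚ.* M m (suc n)) (ιᵠ n ℚ.* M m n) ⟨
    ℚ→ℂ (ιᵠ (suc n) ℚ.* M m (suc n) ℚ.+ ιᵠ n ℚ.* M m n)
      ≈⟨ ℂᵣ.reflexive (≡.cong ℚ→ℂ (ln^-recurrence m n)) ⟩
    ℚ→ℂ (ιᵠ m ℚ.* M (pred m) n)
      ≈⟨ ℚ→ℂ-ι-* m (M (pred m) n) ⟩
    ι m * q (pred m) n ∎
    where
    M : ℕ → PowerSeries
    M = ln[1+z] ^ˢ_
  term : ∀ x c i l → x * c * ℚ→ℂ (i !/ l !) * (- 1ℂ) ^ l * b ^ l * ℚ→ℂ (s l i) ≈ x * c * (q i l * (- b) ^ l)
  term x c i l = begin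
    x * c * ℚ→ℂ (i !/ l !) * (- 1ℂ) ^ l * b ^ l * ℚ→ℂ (s l i)
      ≈⟨ solve 6 (λ x c f e b s → ((((x :* c) :* f) :* e) :* b) :* s := (x :* c) :* ((f :* s) :* (e :* b))) ℂᵣ.refl
           x c (ℚ→ℂ (i !/ l !)) ((- 1ℂ) ^ l) (b ^ l) (ℚ→ℂ (s l i)) ⟩
    x * c * ((ℚ→ℂ (i !/ l !) * ℚ→ℂ (s l i)) * ((- 1ℂ) ^ l * b ^ l))
      ≈⟨ ℂᵣ.*-congˡ (ℂᵣ.*-cong (!/!-s i l) ([-1]^*^ b l)) ⟩
    x * c * (q i l * (- b) ^ l) ∎
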